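{- For any $n\ge1$, $$\sum_{\pi\in\mathfrak{S}_n(213)}(-1)^{\mathsf{exc}\,\pi}=\sum_{\pi\in\mathfrak{S}_n(132)}(-1)^{\mathsf{exc}\,\pi}=\begin{cases}0,&n\text{ even},\\(-1)^{(n-1)/2}C_{(n-1)/2},&n\text{ odd},\end{cases}$$ $$\sum_{\pi\in\mathfrak{D}_n(213)}(-1)^{\mathsf{exc}\,\pi}=\sum_{\pi\in\mathfrak{D}_n(132)}(-1)^{\mathsf{exc}\,\pi}=\begin{cases}(-1)^{n/2}C_{n/2},&n\text{ even},\\0,&n\text{ odd}.\end{cases}$$
   Context: $C_m=\frac{1}{m+1}\binom{2m}{m}$ is the Catalan number. $\mathfrak{S}_n(\tau)$: permutations of $[n]$ avoiding classical pattern $\tau$; $\mathfrak{D}_n(\tau)$: those with no fixed point (derangements). $\mathsf{exc}\,\pi=\#\{i:\pi(i)>i\}$. -}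

module Defs where

open import Data.Fin using (Fin; zero; suc; _<_)
open import Data.Fin.Properties using (_≟_; _<?_; all?; any?)
open import Data.Integer using (ℤ; 0ℤ; -1ℤ) renaming (_+_ to _+ℤ_; _^_ to _^ℤ_)
open import Data.List using (List; []; _∷_; length; map; foldr; filter; allFin; cartesianProductWith)
open import Data.List.Membership.Propositional using (_∈_; find; lose)
open import Data.List.Membership.Propositional.Properties using (∈-cartesianProductWith⁺; ∈-allFin; ∈-filter⁺; ∈-filter⁻)
open import Data.List.Relation.Unary.Any using (here) renaming (any? to anyList?)
open import Data.List.Relation.Unary.All using ([])
open import Data.List.Relation.Unary.AllPairs using ([]; _∷_)
open import Data.List.Relation.Unary.Unique.Propositional using (Unique)
import Data.List.Relation.Unary.Unique.Propositional.Properties as Unique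
open import Data.Nat using (ℕ; zero; suc; _*_; _/_)
open import Data.Nat.Combinatorics using (_C_)
open import Data.Product using (∃; _×_; _,_; proj₂)
open import Data.Vec using (Vec; []; _∷_; lookup)
open import Data.Vec.Properties using (∷-injective)
open import Function using (_∘_)
open import Function.Bundles using (_⇔_; mk⇔; Equivalence)
open import Function.Consequences.Propositional using (strictlySurjective⇒surjective; surjective⇒strictlySurjective)
open import Function.Definitions using (Bijective; Injective; Surjective)
open import Relation.Binary.PropositionalEquality using (_≡_; _≢_; refl)
open import Relation.Nullary using (¬_; Dec; ¬?)
open import Relation.Nullary.Decidable using (map′; _×-dec_; _→-dec_)
open import Relation.Unary using (Decidable)

-- The division is exact.
catalan : ℕ → ℕ
catalan m = ((2 * m) C m) / suc m

-- A map f : [k] → [m] is stored as the word f(1) … f(k), with [m]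
-- represented by Fin m, so positions and values are both shifted down by 1.
Word : ℕ → ℕ → Set
Word m k = Vec (Fin m) k

IsPermutation : ∀ {n} → Word n n → Set
IsPermutation π = Bijective _≡_ _≡_ (lookup π)

-- i lists the positions of a subsequence of π order-isomorphic to τ.
IsOccurrence : ∀ {k n} → Word k k → Word n n → Word n k → Set
IsOccurrence {k} τ π i =
  (∀ (a b : Fin k) → a < b → lookup i a < lookup i b) ×
  (∀ (a b : Fin k) → (lookup τ a < lookup τ b) ⇔ (lookup π (lookup i a) < lookup π (lookup i b)))

Contains : ∀ {k n} → Word k k → Word n n → Set
Contains {k} {n} τ π = ∃ λ (i : Word n k) → IsOccurrence τ π i

Avoids : ∀ {k n} → Word k k → Word n n → Set
Avoids τ π = ¬ Contains τ π

NoFixedPoint : ∀ {n} → Word n n → Set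
NoFixedPoint {n} π = ∀ (i : Fin n) → lookup π i ≢ i

p213 p132 : Word 3 3
p213 = suc zero ∷ zero ∷ suc (suc zero) ∷ []
p132 = zero ∷ suc (suc zero) ∷ suc zero ∷ []

words : ∀ m k → List (Word m k)
words m zero    = [] ∷ []
words m (suc k) = cartesianProductWith _∷_ (allFin m) (words m k)

∈-words : ∀ {m k} (w : Word m k) → w ∈ words m k
∈-words []      = here refl
∈-words (x ∷ w) = ∈-cartesianProductWith⁺ _∷_ (∈-allFin x) (∈-words w)

words-unique : ∀ m k → Unique (words m k)
words-unique m zero    = [] ∷ []
words-unique m (suc k) =
  Unique.cartesianProductWith⁺ _∷_ ∷-injective (Unique.allFin⁺ m) (words-unique m k)

⇔-dec : ∀ {A B : Set} → Dec A → Dec B → Dec (A ⇔ B)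
⇔-dec A? B? =
  map′ (λ (f , g) → mk⇔ f g) (λ e → Equivalence.to e , Equivalence.from e)
       ((A? →-dec B?) ×-dec (B? →-dec A?))

isPermutation? : ∀ {n} → Decidable (IsPermutation {n})
isPermutation? {n} π = injective? ×-dec surjective?
  where
  injective? : Dec (Injective _≡_ _≡_ (lookup π))
  injective? = map′ (λ h {x} {y} → h x y) (λ h x y → h {x} {y})
    (all? λ x → all? λ y → (lookup π x ≟ lookup π y) →-dec (x ≟ y))

  surjective? : Dec (Surjective _≡_ _≡_ (lookup π))
  surjective? = map′ strictlySurjective⇒surjective surjective⇒strictlySurjective
    (all? λ y → any? λ x → lookup π x ≟ y)

isOccurrence? : ∀ {k n} (τ : Word k k) (π : Word n n) → Decidable (IsOccurrence τ π)
isOccurrence? τ π i =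
  (all? λ a → all? λ b → (a <? b) →-dec (lookup i a <? lookup i b)) ×-dec
  (all? λ a → all? λ b →
    ⇔-dec (lookup τ a <? lookup τ b) (lookup π (lookup i a) <? lookup π (lookup i b)))

contains? : ∀ {k n} (τ : Word k k) → Decidable (Contains {k} {n} τ)
contains? {k} {n} τ π =
  map′ (λ p → let (i , _ , occ) = find p in i , occ) (λ (i , occ) → lose (∈-words i) occ)
       (anyList? (isOccurrence? τ π) (words n k))

avoids? : ∀ {k n} (τ : Word k k) → Decidable (Avoids {k} {n} τ)
avoids? τ π = ¬? (contains? τ π)

noFixedPoint? : ∀ {n} → Decidable (NoFixedPoint {n})
noFixedPoint? π = all? λ i → ¬? (lookup π i ≟ i)

𝔖 : ∀ {k} (n : ℕ) → Word k k → List (Word n n)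
𝔖 n τ = filter (λ π → isPermutation? π ×-dec avoids? τ π) (words n n)

𝔇 : ∀ {k} (n : ℕ) → Word k k → List (Word n n)
𝔇 n τ = filter noFixedPoint? (𝔖 n τ)

-- 𝔖 n τ and 𝔇 n τ list each element of the intended sets exactly once.

∈-𝔖 : ∀ {k n} {τ : Word k k} {π : Word n n} →
      π ∈ 𝔖 n τ ⇔ (IsPermutation π × Avoids τ π)
∈-𝔖 {n = n} {τ} {π} = mk⇔ (proj₂ ∘ ∈-filter⁻ P? {xs = words n n}) (∈-filter⁺ P? (∈-words π))
  where
  P? : Decidable (λ (σ : Word n n) → IsPermutation σ × Avoids τ σ)
  P? σ = isPermutation? σ ×-dec avoids? τ σ

∈-𝔇 : ∀ {k n} {τ : Word k k} {π : Word n n} →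
      π ∈ 𝔇 n τ ⇔ (π ∈ 𝔖 n τ × NoFixedPoint π)
∈-𝔇 {n = n} {τ} = mk⇔ (∈-filter⁻ noFixedPoint? {xs = 𝔖 n τ})
                      (λ (π∈ , nf) → ∈-filter⁺ noFixedPoint? π∈ nf)

𝔖-unique : ∀ {k} n (τ : Word k k) → Unique (𝔖 n τ)
𝔖-unique n τ = Unique.filter⁺ _ (words-unique n n)

𝔇-unique : ∀ {k} n (τ : Word k k) → Unique (𝔇 n τ)
𝔇-unique n τ = Unique.filter⁺ _ (𝔖-unique n τ)

exc : ∀ {n} → Word n n → ℕ
exc {n} π = length (filter (λ i → i <? lookup π i) (allFin n))

∑[-1]^exc : ∀ {n} → List (Word n n) → ℤ
∑[-1]^exc πs = foldr _+ℤ_ 0ℤ (map (λ π → -1ℤ ^ℤ exc π) πs)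

{-# OPTIONS --safe #-}

-- Write a 132-avoiding permutation as σ n τ with every entry of σ above every
-- entry of τ.  Iterating, it becomes a Dyck path whose tunnels are the entries, an
-- entry being an excedance (a fixed point) when the midpoint of its tunnel lies to
-- the right of (on) the vertical line through the middle of the path.  So both sums
-- count Dyck paths with a sign -1 per right tunnel and a factor x (1 or 0) per
-- centred tunnel.  Reading the steps of a path alternately from its two ends turns
-- such a sum into a two-term recurrence in the number of steps left unmatched,
-- which is solved by the coefficients of the powers of C(-z²), where C is the
-- Catalan generating function.  The reverse-complement maps 213 to 132 and
-- exchanges left and right tunnels, which reflecting the path undoes.
module Submission where

open import Defs
open import Data.Bool using (true; false; if_then_else_)
open import Data.Fin as Fin using (Fin; zero; suc; toℕ; fromℕ; fromℕ<; inject₁; opposite)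
import Data.Fin.Properties as Fin
open import Data.Integer using (ℤ; 0ℤ; 1ℤ; -1ℤ; _*_; _^_; _-_; -_) renaming (+_ to pos; _+_ to _+ℤ_)
import Data.Integer.Properties as ℤ
import Data.Integer.Tactic.RingSolver as ℤ-Ring
open import Data.List using (List; []; _∷_; _++_; map; length; upTo; foldr; filter; tabulate; cartesianProduct)
open import Data.List.Properties using (length-++; length-map; length-upTo; ∷-injective; map-injective; map-∘)
open import Data.List.Membership.Propositional using (_∈_)
open import Data.List.Membership.Propositional.Properties using (∈-∃++; ∈-++⁺ˡ; ∈-++⁺ʳ; ∈-++⁻; ∈-upTo⁺; ∈-upTo⁻; ∈-map⁺; ∈-map⁻; ∈-cartesianProduct⁺; ∈-cartesianProduct⁻)
open import Data.List.Membership.Propositional.Properties.WithK using (unique∧set⇒bag)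
open import Data.List.Relation.Binary.BagAndSetEquality using (∼bag⇒↭)
open import Data.List.Relation.Binary.Permutation.Propositional using (_↭_; ↭⇒↭ₛ)
import Data.List.Relation.Binary.Permutation.Propositional.Properties as ↭
import Data.List.Relation.Binary.Permutation.Setoid.Properties as ↭ₛ
open import Data.List.Relation.Unary.All as All using (All; []; _∷_)
import Data.List.Relation.Unary.All.Properties as All
open import Data.List.Relation.Unary.AllPairs as AllPairs using (AllPairs; []; _∷_)
import Data.List.Relation.Unary.AllPairs.Properties as AllPairs
open import Data.List.Relation.Unary.Any using (here; there)
open import Data.List.Relation.Unary.Unique.Propositional using (Unique)
import Data.List.Relation.Unary.Unique.Propositional.Properties as Unique
import Data.Nat as ℕ
open import Data.Nat using (ℕ; zero; suc; _≥_; _≤_; _<_; _+_; _∸_; _/_; z≤n; s≤s)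
open import Data.Nat.Combinatorics using (_C_; nC1≡n; nCk≡nC[n∸k]; k>n⇒nCk≡0; nCk+nC[k+1]≡[n+1]C[k+1])
open import Data.Nat.Divisibility using (_∣?_; _∣_; divides; ∣m+n∣m⇒∣n; ∣1⇒≡1)
import Data.Nat.DivMod as ℕ
import Data.Nat.Properties as ℕ
import Data.Nat.Tactic.RingSolver as ℕ-Ring
open import Data.List.Membership.DecPropositional ℕ._≟_ using (_∈?_)
open import Data.Product using (_×_; _,_; ∃; ∃₂; proj₁; proj₂; uncurry)
open import Data.Sum using (_⊎_; inj₁; inj₂)
open import Data.Vec as Vec using ([]; _∷_; lookup)
open import Data.Vec.Properties using (lookup∘tabulate; tabulate∘lookup; tabulate-cong)
open import Function using (_∘_; id)
open import Function.Bundles using (_⇔_; mk⇔; Equivalence)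
open import Function.Consequences.Propositional using (strictlySurjective⇒surjective; surjective⇒strictlySurjective)
open import Function.Properties.Equivalence using () renaming (trans to ⇔-trans; sym to ⇔-sym)
open import Relation.Binary.Definitions using (tri<; tri≈; tri>)
open import Relation.Binary.PropositionalEquality using (_≡_; _≢_; refl; sym; trans; cong; cong₂; subst; subst₂; module ≡-Reasoning)
open import Relation.Binary.PropositionalEquality.Properties using (setoid)
open import Relation.Nullary using (¬_; ¬?; yes; no; does; contradiction)
open import Relation.Nullary.Decidable using (⌊_⌋; dec-true; dec-false; decidable-stable)
open import Relation.Unary using (Decidable)
open ≡-Reasoning

-- No path is ever constructed: `TunnelSums` keeps only the last-return recurrence, which is what
-- cutting a permutation at its maximum gives, and first returns, reflection and peeling are derived
-- from it. The obstacle is that the weight of a tunnel depends on its absolute position, so a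
-- sub-path is not a shorter instance of the same problem and the starting abscissa `e` has to be
-- carried. Alternating between the two ends removes it: the middle of what remains stays at the
-- central line, up to half a unit, so an arch met at an end has its midpoint on a known side unless
-- it spans the whole remaining word. Its weight is then a constant sign, and forgetting it leaves
-- two unmatched steps whose positions do not matter. Among the arches met this way only a spanning
-- one can be centred, and it requires that no unmatched step be present, which is why the weight
-- `x` is a coefficient in a single clause of the recurrence.

∑[i+j=_] : ℕ → (ℕ → ℕ → ℤ) → ℤ
∑[i+j= zero  ] f = f 0 0
∑[i+j= suc k ] f = f 0 (suc k) +ℤ ∑[i+j= k ] (λ i j → f (suc i) j)

∑-cong : ∀ k {f g : ℕ → ℕ → ℤ} → (∀ i j → i + j ≡ k → f i j ≡ g i j) →
         ∑[i+j= k ] f ≡ ∑[i+j= k ] g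
∑-cong zero    f≗g = f≗g 0 0 refl
∑-cong (suc k) f≗g = cong₂ _+ℤ_ (f≗g 0 (suc k) refl)
  (∑-cong k λ i j i+j≡k → f≗g (suc i) j (cong suc i+j≡k))

∑-+ : ∀ k (f g : ℕ → ℕ → ℤ) →
      ∑[i+j= k ] (λ i j → f i j +ℤ g i j) ≡ ∑[i+j= k ] f +ℤ ∑[i+j= k ] g
∑-+ zero    f g = refl
∑-+ (suc k) f g = trans
  (cong (f 0 (suc k) +ℤ g 0 (suc k) +ℤ_) (∑-+ k (λ i → f (suc i)) (λ i → g (suc i))))
  (interchange (f 0 (suc k)) (g 0 (suc k))
    (∑[i+j= k ] (λ i → f (suc i))) (∑[i+j= k ] (λ i → g (suc i))))
  where
  interchange : ∀ a b c d → (a +ℤ b) +ℤ (c +ℤ d) ≡ (a +ℤ c) +ℤ (b +ℤ d)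
  interchange = ℤ-Ring.solve-∀

∑-*ˡ : ∀ k c (f : ℕ → ℕ → ℤ) →
       ∑[i+j= k ] (λ i j → c * f i j) ≡ c * ∑[i+j= k ] f
∑-*ˡ zero    c f = refl
∑-*ˡ (suc k) c f = trans (cong (c * f 0 (suc k) +ℤ_) (∑-*ˡ k c (λ i → f (suc i))))
  (sym (ℤ.*-distribˡ-+ c (f 0 (suc k)) (∑[i+j= k ] (λ i → f (suc i)))))

∑-*ʳ : ∀ k c (f : ℕ → ℕ → ℤ) →
       ∑[i+j= k ] (λ i j → f i j * c) ≡ ∑[i+j= k ] f * c
∑-*ʳ k c f = trans (∑-cong k λ i j _ → ℤ.*-comm (f i j) c)
                   (trans (∑-*ˡ k c f) (ℤ.*-comm c (∑[i+j= k ] f)))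

∑-last : ∀ k (f : ℕ → ℕ → ℤ) →
         ∑[i+j= suc k ] f ≡ ∑[i+j= k ] (λ i j → f i (suc j)) +ℤ f (suc k) 0
∑-last zero    f = refl
∑-last (suc k) f = trans (cong (f 0 (2 + k) +ℤ_) (∑-last k (λ i → f (suc i))))
  (sym (ℤ.+-assoc (f 0 (2 + k)) (∑[i+j= k ] (λ i j → f (suc i) (suc j))) (f (2 + k) 0)))

∑-swap : ∀ k (f : ℕ → ℕ → ℤ) → ∑[i+j= k ] f ≡ ∑[i+j= k ] (λ i j → f j i)
∑-swap zero    f = refl
∑-swap (suc k) f = begin
  f 0 (suc k) +ℤ ∑[i+j= k ] (λ i j → f (suc i) j) ≡⟨ cong (f 0 (suc k) +ℤ_) (∑-swap k (λ i → f (suc i))) ⟩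
  f 0 (suc k) +ℤ ∑[i+j= k ] (λ i j → f (suc j) i) ≡⟨ ℤ.+-comm (f 0 (suc k)) (∑[i+j= k ] (λ i j → f (suc j) i)) ⟩
  ∑[i+j= k ] (λ i j → f (suc j) i) +ℤ f 0 (suc k) ≡⟨ ∑-last k (λ i j → f j i) ⟨
  ∑[i+j= suc k ] (λ i j → f j i)                  ∎

-- Both sides run over the triples a + b + c = k. The exchange lets a middle piece be joined either
-- to what precedes it or to what follows it.
∑-assoc : ∀ k (g : ℕ → ℕ → ℕ → ℤ) →
          ∑[i+j= k ] (λ m c → ∑[i+j= m ] (λ a b → g a b c)) ≡
          ∑[i+j= k ] (λ a m → ∑[i+j= m ] (λ b c → g a b c))
∑-assoc zero    g = refl
∑-assoc (suc k) g = begin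
  g 0 0 (suc k) +ℤ ∑[i+j= k ] (λ m c → g 0 (suc m) c +ℤ ∑[i+j= m ] (λ a b → g (suc a) b c))
    ≡⟨ cong (g 0 0 (suc k) +ℤ_) (∑-+ k (λ m → g 0 (suc m)) (λ m c → ∑[i+j= m ] (λ a b → g (suc a) b c))) ⟩
  g 0 0 (suc k) +ℤ (∑[i+j= k ] (λ m c → g 0 (suc m) c) +ℤ
                    ∑[i+j= k ] (λ m c → ∑[i+j= m ] (λ a b → g (suc a) b c)))
    ≡⟨ ℤ.+-assoc (g 0 0 (suc k)) (∑[i+j= k ] (λ m → g 0 (suc m)))
                  (∑[i+j= k ] (λ m c → ∑[i+j= m ] (λ a b → g (suc a) b c))) ⟨
  ∑[i+j= suc k ] (g 0) +ℤ ∑[i+j= k ] (λ m c → ∑[i+j= m ] (λ a b → g (suc a) b c))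
    ≡⟨ cong (∑[i+j= suc k ] (g 0) +ℤ_) (∑-assoc k (λ a → g (suc a))) ⟩
  ∑[i+j= suc k ] (g 0) +ℤ ∑[i+j= k ] (λ a m → ∑[i+j= m ] (g (suc a)))
    ∎

-- Dyck paths weighted by tunnel midpoints

-- Q n e stands for the sum over the Dyck paths of semilength n starting at
-- abscissa e, a path being weighted by the product of v over the abscissas of
-- the midpoints of its tunnels (a tunnel joins an up step to the down step
-- matched with it).  last-return splits a path at its last return to the axis.
record TunnelSums (v : ℕ → ℤ) : Set where
  field
    Q           : ℕ → ℕ → ℤ
    Q-zero      : ∀ e → Q 0 e ≡ 1ℤ
    last-return : ∀ n e → Q (suc n) e ≡
      ∑[i+j= n ] (λ i j → v (e + suc n + i) * Q i e * Q j (e + (i + suc i)))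

module Tunnels {v : ℕ → ℤ} (T : TunnelSums v) where
  open TunnelSums T

  -- Induction on `n`. In a path that is not a single arch, the part before the last arch is
  -- non-empty and has a first arch by induction; reassociating then joins the last arch to the
  -- middle part instead.
  first-return : ∀ n e → Q (suc n) e ≡
    ∑[i+j= n ] (λ i j → v (e + suc i) * Q i (suc e) * Q j (suc e + (i + suc i)))
  first-return n = bounded n n ℕ.≤-refl
    where
    bounded : ∀ b n → n ≤ b → ∀ e → Q (suc n) e ≡
      ∑[i+j= n ] (λ i j → v (e + suc i) * Q i (suc e) * Q j (suc e + (i + suc i)))
    bounded b zero _ e = begin
      Q 1 e                                ≡⟨ last-return 0 e ⟩
      v (e + 1 + 0) * Q 0 e * Q 0 (e + 1)  ≡⟨ cong₂ _*_ (cong₂ _*_ (cong v (ℕ.+-identityʳ (e + 1))) (trans (Q-zero e) (sym (Q-zero (suc e)))))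
                                                (trans (Q-zero _) (sym (Q-zero _))) ⟩
      v (e + 1) * Q 0 (suc e) * Q 0 (suc e + 1) ∎
    bounded (suc b) (suc n) (s≤s n≤b) e = begin
      Q (2 + n) e
        ≡⟨ last-return (suc n) e ⟩
      v (e + (2 + n) + 0) * Q 0 e * Q (suc n) (e + 1) +ℤ
      ∑[i+j= n ] (λ i j → v (e + (2 + n) + suc i) * Q (suc i) e * Q j (e + (suc i + (2 + i))))
        -- The single-arch path is the term i = 0 of one sum and the term j = 0 of the other, hence
        -- the commutation and `∑-last` below.
        ≡⟨ cong₂ _+ℤ_ edge (trans (∑-cong n splitˡ) (trans (∑-assoc n arches) (∑-cong n splitʳ))) ⟩
      v (e + (2 + n)) * Q (suc n) (suc e) * Q 0 (suc e + (suc n + (2 + n))) +ℤ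
      ∑[i+j= n ] (λ i j → v (e + suc i) * Q i (suc e) * Q (suc j) (suc e + (i + suc i)))
        ≡⟨ ℤ.+-comm (v (e + (2 + n)) * Q (suc n) (suc e) * Q 0 (suc e + (suc n + (2 + n)))) _ ⟩
      _
        ≡⟨ ∑-last n (λ i j → v (e + suc i) * Q i (suc e) * Q j (suc e + (i + suc i))) ⟨
      ∑[i+j= suc n ] (λ i j → v (e + suc i) * Q i (suc e) * Q j (suc e + (i + suc i)))
        ∎
      where
      edge : v (e + (2 + n) + 0) * Q 0 e * Q (suc n) (e + 1) ≡
             v (e + (2 + n)) * Q (suc n) (suc e) * Q 0 (suc e + (suc n + (2 + n)))
      edge rewrite Q-zero e | Q-zero (suc e + (suc n + (2 + n))) | ℕ.+-identityʳ (e + (2 + n)) | ℕ.+-comm e 1 =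
        swap (v (e + (2 + n))) (Q (suc n) (suc e))
        where
        swap : ∀ a b → a * 1ℤ * b ≡ a * b * 1ℤ
        swap = ℤ-Ring.solve-∀

      -- Paths with at least two arches at ground level: a and c are the semilengths enclosed by the
      -- first and the last of them, b that of the part between.
      arches : ℕ → ℕ → ℕ → ℤ
      arches a b c =
        v (e + suc a) * Q a (suc e) *
        (v (e + (2 + n) + suc (a + b)) * Q b (suc e + (a + suc a)) * Q c (e + (suc (a + b) + (2 + (a + b)))))

      splitˡ : ∀ m c → m + c ≡ n →
        v (e + (2 + n) + suc m) * Q (suc m) e * Q c (e + (suc m + (2 + m))) ≡
        ∑[i+j= m ] (λ a b → arches a b c)
      splitˡ m c m+c≡n = begin
        x * Q (suc m) e * z
          ≡⟨ cong (λ y → x * y * z) (bounded b m (ℕ.≤-trans (ℕ.m+n≤o⇒m≤o m (ℕ.≤-reflexive m+c≡n)) n≤b) e) ⟩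
        x * ∑[i+j= m ] f * z
          ≡⟨ rot x _ z ⟩
        ∑[i+j= m ] f * (x * z)
          ≡⟨ ∑-*ʳ m (x * z) f ⟨
        ∑[i+j= m ] (λ a b → f a b * (x * z))
          ≡⟨ ∑-cong m (λ { a b refl → rearrange (v (e + suc a)) _ _ x z }) ⟩
        ∑[i+j= m ] (λ a b → arches a b c)
          ∎
        where
        x = v (e + (2 + n) + suc m)
        z = Q c (e + (suc m + (2 + m)))
        f : ℕ → ℕ → ℤ
        f a b = v (e + suc a) * Q a (suc e) * Q b (suc e + (a + suc a))
        rot : ∀ x y z → x * y * z ≡ y * (x * z)
        rot = ℤ-Ring.solve-∀
        rearrange : ∀ p q r x z → p * q * r * (x * z) ≡ p * q * (x * r * z)
        rearrange = ℤ-Ring.solve-∀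

      splitʳ : ∀ a m → a + m ≡ n →
        ∑[i+j= m ] (λ b c → arches a b c) ≡
        v (e + suc a) * Q a (suc e) * Q (suc m) (suc e + (a + suc a))
      splitʳ a m refl = begin
        ∑[i+j= m ] (λ b c → arches a b c)
          ≡⟨ ∑-*ˡ m (v (e + suc a) * Q a (suc e)) _ ⟩
        _
          ≡⟨ cong (v (e + suc a) * Q a (suc e) *_) (trans
               (∑-cong m λ b c _ → cong₂ (λ s t → v s * Q b (suc e + (a + suc a)) * Q c t) (mid e a m b) (end e a b))
               (sym (last-return m (suc e + (a + suc a))))) ⟩
        v (e + suc a) * Q a (suc e) * Q (suc m) (suc e + (a + suc a))
          ∎
        where
        mid : ∀ e a m b → e + (2 + (a + m)) + suc (a + b) ≡ suc e + (a + suc a) + suc m + b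
        mid = ℕ-Ring.solve-∀
        end : ∀ e a b → e + (suc (a + b) + (2 + (a + b))) ≡ suc e + (a + suc a) + (b + suc b)
        end = ℕ-Ring.solve-∀

  -- W t k e is the analogous sum over words D₀ s₁ D₁ … s_t D_t, where the D_i are
  -- Dyck paths of total semilength k and the t unmatched steps carry no weight.
  W : ℕ → ℕ → ℕ → ℤ
  W zero    k e = Q k e
  W (suc t) k e = ∑[i+j= k ] (λ i j → Q i e * W t j (e + (i + suc i)))

  W-zero : ∀ t e → W t 0 e ≡ 1ℤ
  W-zero zero    e = Q-zero e
  W-zero (suc t) e = cong₂ _*_ (Q-zero e) (W-zero t (e + 1))

  -- `W` splits off its first factor; peeling at the right end needs the last one, which starts
  -- after i matched pairs and t + 1 unmatched steps.
  W-snoc : ∀ t k e → W (suc t) k e ≡ ∑[i+j= k ] (λ i j → W t i e * Q j (e + (i + i + suc t)))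
  W-snoc zero    k e = ∑-cong k λ i j _ → cong (λ s → Q i e * Q j s) (start e i)
    where
    start : ∀ e i → e + (i + suc i) ≡ e + (i + i + 1)
    start = ℕ-Ring.solve-∀
  W-snoc (suc t) k e = begin
    ∑[i+j= k ] (λ i m → Q i e * W (suc t) m (e + (i + suc i)))
      ≡⟨ ∑-cong k (λ i m _ → trans (cong (Q i e *_) (W-snoc t m (e + (i + suc i)))) (sym (∑-*ˡ m (Q i e) _))) ⟩
    ∑[i+j= k ] (λ i m → ∑[i+j= m ] (λ a b → term i a b))
      ≡⟨ ∑-assoc k term ⟨
    ∑[i+j= k ] (λ m b → ∑[i+j= m ] (λ i a → term i a b))
      ≡⟨ ∑-cong k (λ m b _ → trans (∑-cong m (λ { i a refl → trans
           (sym (ℤ.*-assoc (Q i e) (W t a (e + (i + suc i))) _))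
           (cong (λ s → Q i e * W t a (e + (i + suc i)) * Q b s) (start e i a t)) }))
           (∑-*ʳ m (Q b (e + (m + m + suc (suc t)))) (λ i a → Q i e * W t a (e + (i + suc i))))) ⟩
    ∑[i+j= k ] (λ m b → W (suc t) m e * Q b (e + (m + m + suc (suc t))))
      ∎
    where
    term : ℕ → ℕ → ℕ → ℤ
    term i a b = Q i e * (W t a (e + (i + suc i)) * Q b (e + (i + suc i) + (a + a + suc t)))
    start : ∀ e i a t → e + (i + suc i) + (a + a + suc t) ≡ e + (i + a + (i + a) + suc (suc t))
    start = ℕ-Ring.solve-∀

  -- The first step is either unmatched or starts an arch; in the second case,
  -- forgetting the weight of that arch turns its two ends into unmatched steps.
  W-peelˡ : ∀ t k e → (∀ m → m ≤ e + suc k → v m ≡ 1ℤ) →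
            W (suc t) (suc k) e ≡ W t (suc k) (suc e) +ℤ W (suc (suc t)) k (suc e)
  W-peelˡ t k e v≡1 = cong₂ _+ℤ_ unmatched (begin
    ∑[i+j= k ] (λ i j → Q (suc i) e * W t j (e + (suc i + (2 + i))))
      ≡⟨ ∑-cong k (λ i j i+j≡k → trans
           (cong (_* W t j (e + (suc i + (2 + i)))) (first-return i e))
           (trans (sym (∑-*ʳ i (W t j (e + (suc i + (2 + i)))) _))
                  (∑-cong i λ { a b refl → begin
             v (e + suc a) * Q a (suc e) * Q b (suc e + (a + suc a)) * W t j (e + (suc (a + b) + (2 + (a + b))))
               ≡⟨ cong₂ (λ x s → x * Q a (suc e) * Q b (suc e + (a + suc a)) * W t j s)
                    (v≡1 (e + suc a) (ℕ.+-monoʳ-≤ e (s≤s (ℕ.≤-trans (ℕ.m≤m+n a b) (ℕ.m+n≤o⇒m≤o (a + b) (ℕ.≤-reflexive i+j≡k))))))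
                    (start e a b) ⟩
             1ℤ * Q a (suc e) * Q b (suc e + (a + suc a)) * W t j (suc e + (a + suc a) + (b + suc b))
               ≡⟨ regroup (Q a (suc e)) (Q b (suc e + (a + suc a))) (W t j (suc e + (a + suc a) + (b + suc b))) ⟩
             Q a (suc e) * (Q b (suc e + (a + suc a)) * W t j (suc e + (a + suc a) + (b + suc b)))
               ∎ }))) ⟩
    ∑[i+j= k ] (λ i j → ∑[i+j= i ] (λ a b → term a b j))
      ≡⟨ ∑-assoc k term ⟩
    ∑[i+j= k ] (λ a m → ∑[i+j= m ] (λ b j → term a b j))
      ≡⟨ ∑-cong k (λ a m _ → ∑-*ˡ m (Q a (suc e)) (λ b j → Q b (suc e + (a + suc a)) * W t j (suc e + (a + suc a) + (b + suc b)))) ⟩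
    W (suc (suc t)) k (suc e)
      ∎)
    where
    unmatched : Q 0 e * W t (suc k) (e + 1) ≡ W t (suc k) (suc e)
    unmatched rewrite Q-zero e | ℕ.+-comm e 1 = ℤ.*-identityˡ (W t (suc k) (suc e))

    term : ℕ → ℕ → ℕ → ℤ
    term a b j = Q a (suc e) * (Q b (suc e + (a + suc a)) * W t j (suc e + (a + suc a) + (b + suc b)))

    start : ∀ e a b → e + (suc (a + b) + (2 + (a + b))) ≡ suc e + (a + suc a) + (b + suc b)
    start = ℕ-Ring.solve-∀

    regroup : ∀ x y z → 1ℤ * x * y * z ≡ x * (y * z)
    regroup = ℤ-Ring.solve-∀

  -- The mirror image of `W-peelˡ`: an arch ending the word lies behind t + 1 unmatched steps, which
  -- forces its midpoint to be at least e + k + t + 2. Its forgotten weight is the minus sign.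
  W-peelʳ : ∀ t k e → (∀ m → e + k + suc (suc t) ≤ m → v m ≡ -1ℤ) →
            W (suc t) (suc k) e ≡ W t (suc k) e - W (suc (suc t)) k e
  W-peelʳ t k e v≡-1 = begin
    W (suc t) (suc k) e
      ≡⟨ W-snoc t (suc k) e ⟩
    ∑[i+j= suc k ] (λ i j → W t i e * Q j (e + (i + i + suc t)))
      ≡⟨ ∑-last k (λ i j → W t i e * Q j (e + (i + i + suc t))) ⟩
    ∑[i+j= k ] (λ i j → W t i e * Q (suc j) (e + (i + i + suc t))) +ℤ
    W t (suc k) e * Q 0 (e + (suc k + suc k + suc t))
      ≡⟨ cong₂ _+ℤ_ matched unmatched ⟩
    -1ℤ * W (suc (suc t)) k e +ℤ W t (suc k) e
      ≡⟨ reorder (W (suc (suc t)) k e) (W t (suc k) e) ⟩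
    W t (suc k) e - W (suc (suc t)) k e
      ∎
    where
    reorder : ∀ x y → -1ℤ * x +ℤ y ≡ y - x
    reorder = ℤ-Ring.solve-∀

    regroup : ∀ x y z → x * (-1ℤ * y * z) ≡ -1ℤ * (x * y * z)
    regroup = ℤ-Ring.solve-∀

    unmatched : W t (suc k) e * Q 0 (e + (suc k + suc k + suc t)) ≡ W t (suc k) e
    unmatched rewrite Q-zero (e + (suc k + suc k + suc t)) = ℤ.*-identityʳ (W t (suc k) e)

    mid : ∀ e i t a b → e + (i + i + suc t) + suc (a + b) + a ≡ e + (i + (a + b)) + suc (suc t) + (i + a)
    mid = ℕ-Ring.solve-∀

    start : ∀ e i a t → e + (i + i + suc t) + (a + suc a) ≡ e + (i + a + (i + a) + suc (suc t))
    start = ℕ-Ring.solve-∀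

    term : ℕ → ℕ → ℕ → ℤ
    term i a b = W t i e * Q a (e + (i + i + suc t)) * Q b (e + (i + a + (i + a) + suc (suc t)))

    matched : ∑[i+j= k ] (λ i j → W t i e * Q (suc j) (e + (i + i + suc t))) ≡ -1ℤ * W (suc (suc t)) k e
    matched = begin
      ∑[i+j= k ] (λ i j → W t i e * Q (suc j) (e + (i + i + suc t)))
        ≡⟨ ∑-cong k (λ { i j refl → trans
             (cong (W t i e *_) (last-return j (e + (i + i + suc t))))
             (trans (sym (∑-*ˡ j (W t i e) _))
                    (trans (∑-cong j λ { a b refl → trans
                             (cong₂ (λ x s → W t i e * (x * Q a (e + (i + i + suc t)) * Q b s))
                               (v≡-1 _ (ℕ.≤-trans (ℕ.m≤m+n _ (i + a)) (ℕ.≤-reflexive (sym (mid e i t a b)))))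
                               (start e i a t))
                             (regroup (W t i e) (Q a (e + (i + i + suc t))) (Q b (e + (i + a + (i + a) + suc (suc t))))) })
                           (∑-*ˡ j -1ℤ (term i)))) }) ⟩
      ∑[i+j= k ] (λ i m → -1ℤ * ∑[i+j= m ] (λ a b → term i a b))
        ≡⟨ ∑-*ˡ k -1ℤ (λ i m → ∑[i+j= m ] (λ a b → term i a b)) ⟩
      -1ℤ * ∑[i+j= k ] (λ i m → ∑[i+j= m ] (λ a b → term i a b))
        ≡⟨ cong (-1ℤ *_) (∑-assoc k term) ⟨
      -1ℤ * ∑[i+j= k ] (λ m b → ∑[i+j= m ] (λ i a → term i a b))
        ≡⟨ cong (-1ℤ *_) (trans
             (∑-cong k λ m b _ → trans
               (∑-cong m λ { i a refl → refl })
               (trans (∑-*ʳ m (Q b (e + (m + m + suc (suc t)))) (λ i a → W t i e * Q a (e + (i + i + suc t))))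
                      (cong (_* Q b (e + (m + m + suc (suc t)))) (sym (W-snoc t m e)))))
             (sym (W-snoc (suc t) k e))) ⟩
      -1ℤ * W (suc (suc t)) k e
        ∎

  -- Without unmatched steps the arch opened by the first step may span the whole path; its midpoint
  -- is then e + k + 1, where `v` is not prescribed. `W 1 k (suc e)` gives weight 1 to the first
  -- arch in every case, and the last term corrects this one.
  Q-peelˡ : ∀ k e → (∀ m → m < e + suc k → v m ≡ 1ℤ) →
            Q (suc k) e ≡ W 1 k (suc e) +ℤ (v (e + suc k) - 1ℤ) * Q k (suc e)
  Q-peelˡ zero    e _ = begin
    Q 1 e
      ≡⟨ first-return 0 e ⟩
    v (e + 1) * Q 0 (suc e) * Q 0 (suc e + 1)
      ≡⟨ cong (v (e + 1) * Q 0 (suc e) *_) (Q-zero (suc e + 1)) ⟩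
    v (e + 1) * Q 0 (suc e) * 1ℤ
      ≡⟨ split (v (e + 1)) (Q 0 (suc e)) ⟩
    Q 0 (suc e) * 1ℤ +ℤ (v (e + 1) - 1ℤ) * Q 0 (suc e)
      ≡⟨ cong (λ x → Q 0 (suc e) * x +ℤ (v (e + 1) - 1ℤ) * Q 0 (suc e)) (Q-zero (suc e + 1)) ⟨
    Q 0 (suc e) * Q 0 (suc e + 1) +ℤ (v (e + 1) - 1ℤ) * Q 0 (suc e)
      ∎
    where
    split : ∀ x y → x * y * 1ℤ ≡ y * 1ℤ +ℤ (x - 1ℤ) * y
    split = ℤ-Ring.solve-∀
  Q-peelˡ (suc k) e v≡1 = begin
    Q (2 + k) e
      ≡⟨ first-return (suc k) e ⟩
    ∑[i+j= suc k ] f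
      ≡⟨ ∑-last k f ⟩
    ∑[i+j= k ] (λ i j → f i (suc j)) +ℤ x * y * z
      ≡⟨ cong₂ _+ℤ_
           (∑-cong k λ { i j refl → trans
             (cong (λ a → a * Q i (suc e) * Q (suc j) (suc e + (i + suc i)))
               (v≡1 (e + suc i) (ℕ.+-monoʳ-< e (s≤s (s≤s (ℕ.m≤m+n i j))))))
             (cong (_* Q (suc j) (suc e + (i + suc i))) (ℤ.*-identityˡ (Q i (suc e)))) })
           (cong (x * y *_) (Q-zero (suc e + (suc k + (2 + k))))) ⟩
    s +ℤ x * y * 1ℤ
      ≡⟨ split s x y ⟩
    s +ℤ y * 1ℤ +ℤ (x - 1ℤ) * y
      ≡⟨ cong (λ a → s +ℤ y * a +ℤ (x - 1ℤ) * y) (Q-zero (suc e + (suc k + (2 + k)))) ⟨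
    s +ℤ y * z +ℤ (x - 1ℤ) * y
      ≡⟨ cong (_+ℤ (x - 1ℤ) * y) (∑-last k (λ i j → Q i (suc e) * Q j (suc e + (i + suc i)))) ⟨
    W 1 (suc k) (suc e) +ℤ (x - 1ℤ) * y
      ∎
    where
    f : ℕ → ℕ → ℤ
    f i j = v (e + suc i) * Q i (suc e) * Q j (suc e + (i + suc i))
    x = v (e + (2 + k))
    y = Q (suc k) (suc e)
    z = Q 0 (suc e + (suc k + (2 + k)))
    s = ∑[i+j= k ] (λ i j → Q i (suc e) * Q (suc j) (suc e + (i + suc i)))
    split : ∀ s x y → s +ℤ x * y * 1ℤ ≡ s +ℤ y * 1ℤ +ℤ (x - 1ℤ) * y
    split = ℤ-Ring.solve-∀

-- Reflecting a Dyck path exchanges the decompositions at the first and at the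
-- last return.
Q-reverse : ∀ {v v′} (T : TunnelSums v) (T′ : TunnelSums v′) s →
  (∀ m m′ → m + m′ ≡ s → v m ≡ v′ m′) →
  ∀ n e e′ → e + e′ + (n + n) ≡ s → TunnelSums.Q T n e ≡ TunnelSums.Q T′ n e′
Q-reverse {v} {v′} T T′ s v≡v′ n = bounded n n ℕ.≤-refl
  where
  open TunnelSums T
  open TunnelSums T′ renaming (Q to Q′; Q-zero to Q′-zero; last-return to last-return′)

  bounded : ∀ b n → n ≤ b → ∀ e e′ → e + e′ + (n + n) ≡ s → Q n e ≡ Q′ n e′
  bounded b       zero    _         e e′ _ = trans (Q-zero e) (sym (Q′-zero e′))
  bounded (suc b) (suc n) (s≤s n≤b) e e′ e+e′+2n≡s = begin
    Q (suc n) e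
      ≡⟨ Tunnels.first-return T n e ⟩
    ∑[i+j= n ] f
      ≡⟨ ∑-swap n f ⟩
    ∑[i+j= n ] (λ i j → f j i)
      ≡⟨ ∑-cong n (λ { i j refl → trans
           (cong₂ _*_
             (cong₂ _*_ (v≡v′ _ _ (trans (mid e e′ i j) e+e′+2n≡s))
                        (bounded b j (ℕ.≤-trans (ℕ.m≤n+m j i) n≤b) _ _ (trans (inner e e′ i j) e+e′+2n≡s)))
             (bounded b i (ℕ.≤-trans (ℕ.m≤m+n i j) n≤b) _ _ (trans (outer e e′ i j) e+e′+2n≡s)))
           (swap (v′ (e′ + suc (i + j) + i)) (Q′ j (e′ + (i + suc i))) (Q′ i e′)) }) ⟩
    ∑[i+j= n ] (λ i j → v′ (e′ + suc n + i) * Q′ i e′ * Q′ j (e′ + (i + suc i)))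
      ≡⟨ last-return′ n e′ ⟨
    Q′ (suc n) e′
      ∎
    where
    f : ℕ → ℕ → ℤ
    f i j = v (e + suc i) * Q i (suc e) * Q j (suc e + (i + suc i))
    mid : ∀ e e′ i j → (e + suc j) + (e′ + suc (i + j) + i) ≡ e + e′ + (suc (i + j) + suc (i + j))
    mid = ℕ-Ring.solve-∀
    inner : ∀ e e′ i j → suc e + (e′ + (i + suc i)) + (j + j) ≡ e + e′ + (suc (i + j) + suc (i + j))
    inner = ℕ-Ring.solve-∀
    outer : ∀ e e′ i j → suc e + (j + suc j) + e′ + (i + i) ≡ e + e′ + (suc (i + j) + suc (i + j))
    outer = ℕ-Ring.solve-∀
    swap : ∀ x y z → x * y * z ≡ x * z * y
    swap = ℤ-Ring.solve-∀

-- Peel a word counted by W alternately at its left and at its right end, keeping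
-- the line c in the middle: every arch met from the left then lies to the left of
-- c and conversely, so only the number of unmatched steps matters.  α x r k and
-- β x r k are the resulting values of W (2r) k and W (2r+1) k, where x is the weight
-- of a tunnel centred at c.
mutual
  α : ℤ → ℕ → ℕ → ℤ
  α x r       zero    = 1ℤ
  α x zero    (suc k) = β x 0 k +ℤ (x - 1ℤ) * α x 0 k
  α x (suc r) (suc k) = β x r (suc k) +ℤ β x (suc r) k

  β : ℤ → ℕ → ℕ → ℤ
  β x r zero    = 1ℤ
  β x r (suc k) = α x r (suc k) - α x (suc r) k

module Centred {v : ℕ → ℤ} (T : TunnelSums v) (c : ℕ)
  (v-< : ∀ m → m < c → v m ≡ 1ℤ) (v-> : ∀ m → c < m → v m ≡ -1ℤ) where
  open TunnelSums T
  open Tunnels T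

  mutual
    -- A word counted by `W t k e` has 2k + t steps from e on, so the equation makes c its middle
    -- here and half a unit left of its middle in `W-odd`. Even words are peeled at the left and odd
    -- ones at the right, so the two cases feed each other.
    W-even : ∀ r k e → e + k + r ≡ c → W (r ℕ.* 2) k e ≡ α (v c) r k
    W-even r       zero    e _  = W-zero (r ℕ.* 2) e
    W-even zero    (suc k) e refl = begin
      Q (suc k) e
        ≡⟨ Q-peelˡ k e (λ m m< → v-< m (ℕ.<-≤-trans m< (ℕ.m≤m+n _ 0))) ⟩
      W 1 k (suc e) +ℤ (v (e + suc k) - 1ℤ) * Q k (suc e)
        ≡⟨ cong₂ _+ℤ_ (W-odd 0 k (suc e) centre)
             (cong₂ (λ s y → (v s - 1ℤ) * y) (sym (ℕ.+-identityʳ (e + suc k))) (W-even 0 k (suc e) centre)) ⟩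
      β (v c) 0 k +ℤ (v c - 1ℤ) * α (v c) 0 k
        ∎
      where
      centre : suc e + k + 0 ≡ e + suc k + 0
      centre = cong (_+ 0) (sym (ℕ.+-suc e k))
    W-even (suc r) (suc k) e refl = trans
      (W-peelˡ (suc (r ℕ.* 2)) k e (λ m m≤ → v-< m (ℕ.≤-<-trans m≤ (ℕ.m<m+n (e + suc k) (s≤s z≤n)))))
      (cong₂ _+ℤ_ (W-odd r (suc k) (suc e) (sym (ℕ.+-suc (e + suc k) r)))
                  (W-odd (suc r) k (suc e) (cong (_+ suc r) (sym (ℕ.+-suc e k)))))

    W-odd : ∀ r k e → e + k + r ≡ c → W (suc (r ℕ.* 2)) k e ≡ β (v c) r k
    W-odd r zero    e _    = W-zero (suc (r ℕ.* 2)) e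
    W-odd r (suc k) e refl = trans
      (W-peelʳ (r ℕ.* 2) k e (λ m ≤m → v-> m (ℕ.<-≤-trans bound ≤m)))
      (cong₂ _-_ (W-even r (suc k) e refl)
                 (W-even (suc r) k e (trans (ℕ.+-suc (e + k) r) (cong (_+ r) (sym (ℕ.+-suc e k))))))
      where
      bound : e + suc k + r < e + k + suc (suc (r ℕ.* 2))
      bound = ℕ.≤-trans (ℕ.m≤m+n (suc (e + suc k + r)) r) (ℕ.≤-reflexive (lemma e k r))
        where
        lemma : ∀ e k r → suc (e + suc k + r) + r ≡ e + k + suc (suc (r ℕ.* 2))
        lemma = ℕ-Ring.solve-∀

  Q-centred : Q c 0 ≡ α (v c) 0 c
  Q-centred = W-even 0 c 0 (ℕ.+-identityʳ c)

-- Catalan numbers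

-- κ p j is the coefficient of y^j in C(-y)^p, where C is the Catalan generating function.
κ : ℕ → ℕ → ℤ
κ p       zero    = 1ℤ
κ zero    (suc j) = 0ℤ
κ (suc p) (suc j) = κ p (suc j) - κ (suc (suc p)) j

mutual
  -- With C for C(-z²), let A_r = C^r + z C^(r+1) and B_r = C^(r+1). Since C = 1 - z² C², they
  -- satisfy A_(r+1) = B_r + z B_(r+1) and B_r = A_r - z A_(r+1), and A_0 = 1 + z B_0: the
  -- recurrences of `α` and `β` at x = 1. The four statements read off the even and the odd
  -- coefficients.
  α₁-even : ∀ r j → α 1ℤ r (j ℕ.* 2) ≡ κ r j
  α₁-even r       zero    = refl
  α₁-even zero    (suc j) rewrite β₁-odd 0 j = refl
  α₁-even (suc r) (suc j) rewrite β₁-even r (suc j) | β₁-odd (suc r) j = ℤ.+-identityʳ (κ (suc r) (suc j))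

  α₁-odd : ∀ r j → α 1ℤ r (suc (j ℕ.* 2)) ≡ κ (suc r) j
  α₁-odd zero    j rewrite β₁-even 0 j = ℤ.+-identityʳ (κ 1 j)
  α₁-odd (suc r) j rewrite β₁-odd r j | β₁-even (suc r) j = ℤ.+-identityˡ (κ (suc (suc r)) j)

  β₁-even : ∀ r j → β 1ℤ r (j ℕ.* 2) ≡ κ (suc r) j
  β₁-even r zero    = refl
  β₁-even r (suc j) = cong₂ _-_ (α₁-even r (suc j)) (α₁-odd (suc r) j)

  β₁-odd : ∀ r j → β 1ℤ r (suc (j ℕ.* 2)) ≡ 0ℤ
  β₁-odd r j = trans (cong₂ _-_ (α₁-odd r j) (α₁-even (suc r) j)) (ℤ.+-inverseʳ (κ (suc r) j))

mutual
  -- At x = 0 the initial relation becomes A_0 = 1 + z B_0 - z A_0, which is met by A_r = C^(r+1)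
  -- and B_r = C^(r+1) - z C^(r+2). Now it is `α` that vanishes in odd degrees.
  α₀-even : ∀ r j → α 0ℤ r (j ℕ.* 2) ≡ κ (suc r) j
  α₀-even r       zero    = refl
  α₀-even zero    (suc j) = trans
    (cong₂ (λ x y → x +ℤ (0ℤ - 1ℤ) * y) (β₀-odd 0 j) (α₀-odd 0 j))
    (trans (ℤ.+-identityʳ (- κ 2 j)) (sym (ℤ.+-identityˡ (- κ 2 j))))
  α₀-even (suc r) (suc j) = cong₂ _+ℤ_ (β₀-even r (suc j)) (β₀-odd (suc r) j)

  α₀-odd : ∀ r j → α 0ℤ r (suc (j ℕ.* 2)) ≡ 0ℤ
  α₀-odd zero    j = trans
    (cong₂ (λ x y → x +ℤ (0ℤ - 1ℤ) * y) (β₀-even 0 j) (α₀-even 0 j)) (cancel (κ 1 j))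
    where
    cancel : ∀ x → x +ℤ (0ℤ - 1ℤ) * x ≡ 0ℤ
    cancel = ℤ-Ring.solve-∀
  α₀-odd (suc r) j = trans (cong₂ _+ℤ_ (β₀-odd r j) (β₀-even (suc r) j)) (ℤ.+-inverseˡ (κ (suc (suc r)) j))

  β₀-even : ∀ r j → β 0ℤ r (j ℕ.* 2) ≡ κ (suc r) j
  β₀-even r zero    = refl
  β₀-even r (suc j) = trans (cong₂ _-_ (α₀-even r (suc j)) (α₀-odd (suc r) j))
                            (ℤ.+-identityʳ (κ (suc r) (suc j)))

  β₀-odd : ∀ r j → β 0ℤ r (suc (j ℕ.* 2)) ≡ - κ (suc (suc r)) j
  β₀-odd r j = trans (cong₂ _-_ (α₀-odd r j) (α₀-even (suc r) j)) (ℤ.+-identityˡ (- κ (suc (suc r)) j))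

-- The coefficient of y^j in C(y)^p, that is, `κ` without its signs: the recurrence is C^(p+1) = C^p
-- + y C^(p+2).
ballot : ℕ → ℕ → ℕ
ballot p       zero    = 1
ballot zero    (suc j) = 0
ballot (suc p) (suc j) = ballot p (suc j) + ballot (suc (suc p)) j

κ≡±ballot : ∀ p j → κ p j ≡ -1ℤ ^ j * pos (ballot p j)
κ≡±ballot p       zero    = refl
κ≡±ballot zero    (suc j) = sym (ℤ.*-zeroʳ (-1ℤ ^ suc j))
κ≡±ballot (suc p) (suc j) = begin
  κ p (suc j) - κ (suc (suc p)) j
    ≡⟨ cong₂ _-_ (κ≡±ballot p (suc j)) (κ≡±ballot (suc (suc p)) j) ⟩
  -1ℤ * s * pos (ballot p (suc j)) - s * pos (ballot (suc (suc p)) j)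
    ≡⟨ factor s (pos (ballot p (suc j))) (pos (ballot (suc (suc p)) j)) ⟩
  -1ℤ * s * (pos (ballot p (suc j)) +ℤ pos (ballot (suc (suc p)) j))
    ∎
  where
  s = -1ℤ ^ j
  factor : ∀ s x y → -1ℤ * s * x - s * y ≡ -1ℤ * s * (x +ℤ y)
  factor = ℤ-Ring.solve-∀

-- Pascal's rule gives the differences of neighbouring binomials the recurrence of `ballot`, and for
-- p = 0 the two middle entries of the row 2j + 1 agree. This is the reflection formula, kept
-- additive to avoid truncated subtraction.
ballot+C≡C : ∀ p j → ballot p (suc j) + (j + suc j + p) C j ≡ (j + suc j + p) C suc j
ballot+C≡C zero j = begin
  (j + suc j + 0) C j        ≡⟨ cong (_C j) (ℕ.+-identityʳ (j + suc j)) ⟩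
  (j + suc j) C j            ≡⟨ nCk≡nC[n∸k] (ℕ.m≤m+n j (suc j)) ⟩
  (j + suc j) C (j + suc j ∸ j) ≡⟨ cong ((j + suc j) C_) (ℕ.m+n∸m≡n j (suc j)) ⟩
  (j + suc j) C suc j        ≡⟨ cong (_C suc j) (ℕ.+-identityʳ (j + suc j)) ⟨
  (j + suc j + 0) C suc j    ∎
ballot+C≡C (suc p) zero = begin
  ballot p 1 + 1 + 1       ≡⟨ cong (_+ 1) (ballot+C≡C p 0) ⟩
  (1 + p) C 1 + 1          ≡⟨ ℕ.+-comm ((1 + p) C 1) 1 ⟩
  (1 + p) C 0 + (1 + p) C 1  ≡⟨ nCk+nC[k+1]≡[n+1]C[k+1] (1 + p) 0 ⟩
  (2 + p) C 1              ∎
ballot+C≡C (suc p) (suc j) = begin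
  ballot p (2 + j) + ballot (2 + p) (1 + j) + (suc j + (2 + j) + suc p) C suc j
    ≡⟨ cong (λ n → ballot p (2 + j) + ballot (2 + p) (1 + j) + n C suc j) (ℕ.+-suc (suc j + (2 + j)) p) ⟩
  ballot p (2 + j) + ballot (2 + p) (1 + j) + suc n C suc j
    ≡⟨ cong (λ x → ballot p (2 + j) + ballot (2 + p) (1 + j) + x) (nCk+nC[k+1]≡[n+1]C[k+1] n j) ⟨
  ballot p (2 + j) + ballot (2 + p) (1 + j) + (n C j + n C suc j)
    ≡⟨ regroup (ballot p (2 + j)) _ _ _ ⟩
  (ballot (2 + p) (1 + j) + n C j) + (ballot p (2 + j) + n C suc j)
    ≡⟨ cong₂ _+_ (subst (λ n → ballot (2 + p) (1 + j) + n C j ≡ n C suc j) (size j p) (ballot+C≡C (2 + p) j))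
                 (ballot+C≡C p (suc j)) ⟩
  n C suc j + n C (2 + j)
    ≡⟨ nCk+nC[k+1]≡[n+1]C[k+1] n (suc j) ⟩
  suc n C (2 + j)
    ≡⟨ cong (_C (2 + j)) (ℕ.+-suc (suc j + (2 + j)) p) ⟨
  (suc j + (2 + j) + suc p) C (2 + j)
    ∎
  where
  n = suc j + (2 + j) + p
  size : ∀ j p → j + suc j + (2 + p) ≡ suc j + (2 + j) + p
  size = ℕ-Ring.solve-∀
  regroup : ∀ a b c d → a + b + (c + d) ≡ (b + c) + (a + d)
  regroup = ℕ-Ring.solve-∀

C-absorb : ∀ n k → suc k ℕ.* (suc n C suc k) ≡ suc n ℕ.* (n C k)
C-absorb n       zero    = begin
  1 ℕ.* (suc n C 1) ≡⟨ ℕ.*-identityˡ (suc n C 1) ⟩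
  suc n C 1       ≡⟨ nC1≡n (suc n) ⟩
  suc n           ≡⟨ ℕ.*-identityʳ (suc n) ⟨
  suc n ℕ.* 1     ∎
C-absorb zero    (suc k) = begin
  suc (suc k) ℕ.* (1 C suc (suc k)) ≡⟨ cong (suc (suc k) ℕ.*_) (k>n⇒nCk≡0 {1} {suc (suc k)} (s≤s (s≤s z≤n))) ⟩
  suc (suc k) ℕ.* 0               ≡⟨ ℕ.*-zeroʳ (suc (suc k)) ⟩
  0                               ≡⟨ cong (1 ℕ.*_) (k>n⇒nCk≡0 {0} {suc k} (s≤s z≤n)) ⟨
  1 ℕ.* (0 C suc k)                 ∎
C-absorb (suc n) (suc k) = begin
  (2 + k) ℕ.* ((2 + n) C (2 + k))
    ≡⟨ cong ((2 + k) ℕ.*_) (nCk+nC[k+1]≡[n+1]C[k+1] (suc n) (suc k)) ⟨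
  (2 + k) ℕ.* (x + suc n C (2 + k))
    ≡⟨ expand k x (suc n C (2 + k)) ⟩
  x + (suc k ℕ.* x + (2 + k) ℕ.* (suc n C (2 + k)))
    ≡⟨ cong (x +_) (cong₂ _+_ (C-absorb n k) (C-absorb n (suc k))) ⟩
  x + (suc n ℕ.* (n C k) + suc n ℕ.* (n C suc k))
    ≡⟨ cong (x +_) (ℕ.*-distribˡ-+ (suc n) (n C k) (n C suc k)) ⟨
  x + suc n ℕ.* (n C k + n C suc k)
    ≡⟨ cong (λ y → x + suc n ℕ.* y) (nCk+nC[k+1]≡[n+1]C[k+1] n k) ⟩
  (2 + n) ℕ.* x
    ∎
  where
  x = suc n C suc k
  expand : ∀ k x y → (2 + k) ℕ.* (x + y) ≡ x + (suc k ℕ.* x + (2 + k) ℕ.* y)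
  expand = ℕ-Ring.solve-∀

ballot≡catalan : ∀ j → ballot 1 j ≡ catalan j
ballot≡catalan zero    = refl
ballot≡catalan (suc j) = begin
  b                                   ≡⟨ ℕ.m*n/n≡m b (2 + j) ⟨
  (b ℕ.* (2 + j)) / (2 + j)           ≡⟨ cong (_/ (2 + j)) product ⟩
  (n C suc j) / (2 + j)               ≡⟨ cong (λ n → (n C suc j) / (2 + j)) (size j) ⟩
  ((2 ℕ.* suc j) C suc j) / (2 + j)   ∎
  where
  b = ballot 1 (suc j)
  n = j + suc j + 1
  x = n C j
  y = n C suc j

  size : ∀ j → j + suc j + 1 ≡ 2 ℕ.* suc j
  size = ℕ-Ring.solve-∀

  -- Absorption gives (j + 1)(x + y) = (n + 1) x, where n + 1 = (j + 1) + (j + 2). Hence (j + 2)(y -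
  -- x) = y, which turns the difference of binomials into the quotient in `catalan`.
  ratio : (2 + j) ℕ.* x ≡ suc j ℕ.* y
  ratio = ℕ.+-cancelˡ-≡ (suc j ℕ.* x) _ _ (begin
    suc j ℕ.* x + (2 + j) ℕ.* x ≡⟨ collect j x ⟩
    suc n ℕ.* x                 ≡⟨ C-absorb n j ⟨
    suc j ℕ.* (suc n C suc j)     ≡⟨ cong (suc j ℕ.*_) (nCk+nC[k+1]≡[n+1]C[k+1] n j) ⟨
    suc j ℕ.* (x + y)           ≡⟨ ℕ.*-distribˡ-+ (suc j) x y ⟩
    suc j ℕ.* x + suc j ℕ.* y   ∎)
    where
    collect : ∀ j x → suc j ℕ.* x + (2 + j) ℕ.* x ≡ suc (j + suc j + 1) ℕ.* x
    collect = ℕ-Ring.solve-∀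

  product : b ℕ.* (2 + j) ≡ y
  product = ℕ.+-cancelʳ-≡ (suc j ℕ.* y) _ _ (begin
    b ℕ.* (2 + j) + suc j ℕ.* y   ≡⟨ cong (λ z → b ℕ.* (2 + j) + z) ratio ⟨
    b ℕ.* (2 + j) + (2 + j) ℕ.* x ≡⟨ factor b j x ⟩
    (2 + j) ℕ.* (b + x)           ≡⟨ cong ((2 + j) ℕ.*_) (ballot+C≡C 1 j) ⟩
    y + suc j ℕ.* y               ∎)
    where
    factor : ∀ b j x → b ℕ.* (2 + j) + (2 + j) ℕ.* x ≡ (2 + j) ℕ.* (b + x)
    factor = ℕ-Ring.solve-∀

κ₁≡±catalan : ∀ j → κ 1 j ≡ -1ℤ ^ j * pos (catalan j)
κ₁≡±catalan j = trans (κ≡±ballot 1 j) (cong (λ b → -1ℤ ^ j * pos b) (ballot≡catalan j))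

-- The 132-avoiding permutations as words over ℕ

AllPairs-++⁻ : ∀ {A : Set} {R : A → A → Set} xs {ys} → AllPairs R (xs ++ ys) →
               AllPairs R xs × All (λ x → All (R x) ys) xs × AllPairs R ys
AllPairs-++⁻ []       ps       = [] , [] , ps
AllPairs-++⁻ (x ∷ xs) (p ∷ ps) =
  let p₁ , p₂ = All.++⁻ xs p ; ps₁ , cross , ps₂ = AllPairs-++⁻ xs ps
  in p₁ ∷ ps₁ , p₂ ∷ cross , ps₂

Unique-⊆⇒length≤ : ∀ {A : Set} {xs ys : List A} → Unique xs → (∀ {z} → z ∈ xs → z ∈ ys) →
                   length xs ≤ length ys
Unique-⊆⇒length≤ [] _ = z≤n
Unique-⊆⇒length≤ {xs = x ∷ xs} (x∉xs ∷ xs!) xs⊆ys with ∈-∃++ (xs⊆ys (here refl))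
... | as , bs , refl = ℕ.≤-trans
  (s≤s (Unique-⊆⇒length≤ xs! (λ z∈xs → skip (λ { refl → All.lookup x∉xs z∈xs refl }) (xs⊆ys (there z∈xs)))))
  (ℕ.≤-reflexive (trans (cong suc (length-++ as))
    (trans (sym (ℕ.+-suc (length as) (length bs))) (sym (length-++ as)))))
  where
  skip : ∀ {z} → z ≢ x → z ∈ as ++ x ∷ bs → z ∈ as ++ bs
  skip z≢x z∈ with ∈-++⁻ as z∈
  ... | inj₁ z∈as         = ∈-++⁺ˡ z∈as
  ... | inj₂ (here z≡x)   = contradiction z≡x z≢x
  ... | inj₂ (there z∈bs) = ∈-++⁺ʳ as z∈bs

Unique∧bounded⇒length≤ : ∀ {m xs} → Unique xs → All (_< m) xs → length xs ≤ m
Unique∧bounded⇒length≤ {m} xs! xs<m = subst (_ ≤_) (length-upTo m)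
  (Unique-⊆⇒length≤ xs! (∈-upTo⁺ ∘ All.lookup xs<m))

-- Pigeonhole: a missing v would extend xs to n + 1 distinct numbers below n.
Unique∧bounded⇒∈ : ∀ {n xs v} → length xs ≡ n → Unique xs → All (_< n) xs → v < n → v ∈ xs
Unique∧bounded⇒∈ {n} {xs} {v} refl xs! xs<n v<n with v ∈? xs
... | yes v∈xs = v∈xs
... | no  v∉xs = contradiction
  (Unique∧bounded⇒length≤ (All.tabulate (λ { z∈xs refl → v∉xs z∈xs }) ∷ xs!) (v<n ∷ xs<n))
  (ℕ.<-irrefl refl)

-- Each occurrence is charged to its leftmost entry, the 1, so that shifts and concatenations can be
-- treated by structural induction.
data Avoids132 : List ℕ → Set where
  []  : Avoids132 []
  _∷_ : ∀ {x xs} → AllPairs (λ y z → ¬ (x < z × z < y)) xs → Avoids132 xs → Avoids132 (x ∷ xs)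

Avoids132-map⁺ : ∀ i {xs} → Avoids132 xs → Avoids132 (map (i +_) xs)
Avoids132-map⁺ i []       = []
Avoids132-map⁺ i (p ∷ ps) =
  AllPairs.map⁺ (AllPairs.map (λ {y} {z} ¬p (x<z , z<y) → ¬p (ℕ.+-cancelˡ-< i _ _ x<z , ℕ.+-cancelˡ-< i _ _ z<y)) p)
  ∷ Avoids132-map⁺ i ps

Avoids132-map⁻ : ∀ i xs → Avoids132 (map (i +_) xs) → Avoids132 xs
Avoids132-map⁻ i []       []       = []
Avoids132-map⁻ i (x ∷ xs) (p ∷ ps) =
  AllPairs.map (λ ¬p (x<z , z<y) → ¬p (ℕ.+-monoʳ-< i x<z , ℕ.+-monoʳ-< i z<y)) (AllPairs.map⁻ p)
  ∷ Avoids132-map⁻ i xs ps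

smaller⇒no-132 : ∀ {x zs} → All (_< x) zs → AllPairs (λ y z → ¬ (x < z × z < y)) zs
smaller⇒no-132 []         = []
smaller⇒no-132 (_ ∷ zs<x) =
  All.map (λ z<x (x<z , _) → ℕ.<-asym x<z z<x) zs<x ∷ smaller⇒no-132 zs<x

-- Across the separator, a last entry in ys would lie below a first entry in xs; and m, which
-- nothing exceeds, can be neither the first nor the last entry of a pattern.
Avoids132-++⁺ : ∀ {m xs ys} → Avoids132 xs → Avoids132 ys → All (_< m) xs → All (_< m) ys →
                All (λ x → All (_< x) ys) xs → Avoids132 (xs ++ m ∷ ys)
Avoids132-++⁺ []       qs _ ys<m _ = smaller⇒no-132 ys<m ∷ qs
Avoids132-++⁺ {m} {x ∷ xs} {ys} (p ∷ ps) qs (x<m ∷ xs<m) ys<m (ys<x ∷ ys<xs) =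
  AllPairs.++⁺ p (not-above ∷ smaller⇒no-132 ys<x)
    (All.map (λ y<m → (λ (_ , m<y) → ℕ.<-asym m<y y<m) ∷ not-above) xs<m)
  ∷ Avoids132-++⁺ ps qs xs<m ys<m ys<xs
  where
  not-above : ∀ {y} → All (λ z → ¬ (x < z × z < y)) ys
  not-above = All.map (λ z<x (x<z , _) → ℕ.<-asym x<z z<x) ys<x

Avoids132-++⁻ : ∀ xs {m ys} → Avoids132 (xs ++ m ∷ ys) →
  Avoids132 xs × Avoids132 ys × All (λ x → All (λ z → ¬ (x < z × z < m)) ys) xs
Avoids132-++⁻ []       (_ ∷ qs) = [] , qs , []
Avoids132-++⁻ (x ∷ xs) (p ∷ ps) =
  let p₁ , _ , p₂ = AllPairs-++⁻ xs p ; ps₁ , qs , cross = Avoids132-++⁻ xs ps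
  in p₁ ∷ ps₁ , qs , AllPairs.head p₂ ∷ cross

Perm132 : ℕ → List ℕ → Set
Perm132 n xs = length xs ≡ n × All (_< n) xs × Unique xs × Avoids132 xs

-- σ ⊘ τ is the word of the permutation whose maximum separates a shifted copy of σ
-- from τ; in a 132-avoiding permutation everything before the maximum exceeds
-- everything after it.
infixr 5 _⊘_
_⊘_ : List ℕ → List ℕ → List ℕ
σ ⊘ τ = map (length τ +_) σ ++ (length τ + length σ) ∷ τ

⊘-Perm132 : ∀ {i j σ τ} → Perm132 j σ → Perm132 i τ → Perm132 (suc (i + j)) (σ ⊘ τ)
⊘-Perm132 {σ = σ} {τ} (refl , σ<j , σ! , σ-av) (refl , τ<i , τ! , τ-av) =
  trans (length-++ (map (i +_) σ)) (trans (cong (_+ suc i) (length-map (i +_) σ)) (trans (ℕ.+-suc j i) (cong suc (ℕ.+-comm j i)))) ,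
  All.++⁺ (All.map ℕ.m<n⇒m<1+n shifted<) (ℕ.n<1+n _ ∷ All.map ℕ.m<n⇒m<1+n τ<) ,
  Unique.++⁺ (Unique.map⁺ (λ {x} {y} → ℕ.+-cancelˡ-≡ i x y) σ!) (All.map (λ x<m m≡x → ℕ.<⇒≢ x<m (sym m≡x)) τ< ∷ τ!) disjoint ,
  Avoids132-++⁺ (Avoids132-map⁺ i σ-av) τ-av shifted< τ< (All.map⁺ (All.tabulate λ {x} _ → All.map (λ z<i → ℕ.<-≤-trans z<i (ℕ.m≤m+n i x)) τ<i))
  where
  i = length τ
  j = length σ
  shifted< : All (_< i + j) (map (i +_) σ)
  shifted< = All.map⁺ (All.map (ℕ.+-monoʳ-< i) σ<j)
  τ< : All (_< i + j) τ
  τ< = All.map (λ z<i → ℕ.<-≤-trans z<i (ℕ.m≤m+n i j)) τ<i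
  disjoint : ∀ {z} → ¬ (z ∈ map (i +_) σ × z ∈ (i + j) ∷ τ)
  disjoint (z∈σ , here refl) = ℕ.<-irrefl refl (All.lookup shifted< z∈σ)
  disjoint (z∈σ , there z∈τ) with x , _ , refl ← ∈-map⁻ (i +_) z∈σ = ℕ.<⇒≱ (All.lookup τ<i z∈τ) (ℕ.m≤m+n i x)

-- The cut is at the first letter that is not below m.
++-∷-injective : ∀ {m : ℕ} {xs xs′ ys ys′} → All (_< m) xs → All (_< m) xs′ →
                 xs ++ m ∷ ys ≡ xs′ ++ m ∷ ys′ → xs ≡ xs′ × ys ≡ ys′
++-∷-injective []         []          refl = refl , refl
++-∷-injective []         (x<m ∷ _)   refl = contradiction x<m (ℕ.<-irrefl refl)
++-∷-injective (x<m ∷ _)  []          refl = contradiction x<m (ℕ.<-irrefl refl)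
++-∷-injective (_ ∷ xs<m) (_ ∷ xs′<m) eq   with refl , eq′ ← ∷-injective eq =
  let xs≡xs′ , ys≡ys′ = ++-∷-injective xs<m xs′<m eq′ in cong (_ ∷_) xs≡xs′ , ys≡ys′

⊘-injective : ∀ {i j i′ j′ σ τ σ′ τ′} → i + j ≡ i′ + j′ →
  Perm132 j σ → Perm132 i τ → Perm132 j′ σ′ → Perm132 i′ τ′ → σ ⊘ τ ≡ σ′ ⊘ τ′ → σ ≡ σ′ × τ ≡ τ′
⊘-injective {σ = σ} {τ} {σ′} {τ′} i+j≡i′+j′ (refl , σ<j , _) (refl , _) (refl , σ′<j′ , _) (refl , _) eq
  with ++-∷-injective (All.map⁺ (All.map (ℕ.+-monoʳ-< _) σ<j))
         (All.map⁺ (All.map (λ x<j′ → ℕ.<-≤-trans (ℕ.+-monoʳ-< (length τ′) x<j′) (ℕ.≤-reflexive (sym i+j≡i′+j′))) σ′<j′))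
         (trans eq (cong (λ m → map (length τ′ +_) σ′ ++ m ∷ τ′) (sym i+j≡i′+j′)))
... | σ≡ , refl = map-injective (λ {x} {y} → ℕ.+-cancelˡ-≡ (length τ) x y) σ≡ , refl

unshift : ∀ {i xs} → All (i ≤_) xs → ∃ λ ys → xs ≡ map (i +_) ys
unshift []           = [] , refl
unshift (i≤x ∷ i≤xs) =
  let ys , eq = unshift i≤xs in _ ∷ ys , cong₂ _∷_ (sym (ℕ.m+[n∸m]≡n i≤x)) eq

-- The cut is at the maximum n. An entry before it smaller than one after it would form a 132 with n
-- as the 3, so τ takes exactly the i smallest values.
⊘-surjective : ∀ {n xs} → Perm132 (suc n) xs →
  ∃₂ λ i j → i + j ≡ n × ∃₂ λ σ τ → Perm132 j σ × Perm132 i τ × xs ≡ σ ⊘ τ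
⊘-surjective {n} {xs} (len , xs<1+n , xs! , xs-av)
  with ys , τ , refl ← ∈-∃++ (Unique∧bounded⇒∈ len xs! xs<1+n (ℕ.n<1+n n))
  with ys<1+n , _ ∷ τ<1+n ← All.++⁻ ys xs<1+n
  with ys! , ys≢ , (n≢τ ∷ τ!) ← AllPairs-++⁻ ys xs!
  with ys-av , τ-av , no-132 ← Avoids132-++⁻ ys xs-av
  -- An entry of ys exceeds all i distinct entries of τ, hence is at least i.
  = parts (unshift (All.tabulate (λ x∈ys → Unique∧bounded⇒length≤ τ! (All.tabulate (τ<ys x∈ys)))))
  where
  i = length τ

  τ<n : ∀ {z} → z ∈ τ → z < n
  τ<n z∈τ = ℕ.≤∧≢⇒< (ℕ.≤-pred (All.lookup τ<1+n z∈τ)) (λ z≡n → All.lookup n≢τ z∈τ (sym z≡n))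

  τ<ys : ∀ {x z} → x ∈ ys → z ∈ τ → z < x
  τ<ys {x} {z} x∈ys z∈τ with ℕ.<-cmp z x
  ... | tri< z<x _ _ = z<x
  ... | tri≈ _ z≡x _ = contradiction (sym z≡x) (All.lookup (All.lookup ys≢ x∈ys) (there z∈τ))
  ... | tri> _ _ x<z = contradiction (x<z , τ<n z∈τ) (All.lookup (All.lookup no-132 x∈ys) z∈τ)

  -- τ is closed downwards, so along with z it contains z + 1 distinct values.
  τ<i : ∀ {z} → z ∈ τ → z < i
  τ<i {z} z∈τ = subst (_≤ i) (length-upTo (suc z)) (Unique-⊆⇒length≤ (Unique.upTo⁺ (suc z)) initial)
    where
    initial : ∀ {w} → w ∈ upTo (suc z) → w ∈ τ
    initial {w} w∈ with ℕ.≤-pred (∈-upTo⁻ w∈)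
    ... | w≤z with ∈-++⁻ ys (Unique∧bounded⇒∈ len xs! xs<1+n (s≤s (ℕ.<⇒≤ (ℕ.≤-<-trans w≤z (τ<n z∈τ)))))
    ...   | inj₁ w∈ys         = contradiction (τ<ys w∈ys z∈τ) (ℕ.≤⇒≯ w≤z)
    ...   | inj₂ (here refl)  = contradiction (τ<n z∈τ) (ℕ.≤⇒≯ w≤z)
    ...   | inj₂ (there w∈τ)  = w∈τ

  parts : (∃ λ σ → ys ≡ map (i +_) σ) →
          ∃₂ λ i j → i + j ≡ n × ∃₂ λ σ τ′ → Perm132 j σ × Perm132 i τ′ × ys ++ n ∷ τ ≡ σ ⊘ τ′
  parts (σ , refl) =
    i , length σ , i+j≡n , σ , τ ,
    (refl , All.tabulate σ<j , Unique.map⁻ ys! , Avoids132-map⁻ i σ ys-av) ,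
    (refl , All.tabulate τ<i , τ! , τ-av) ,
    cong (λ m → map (i +_) σ ++ m ∷ τ) (sym i+j≡n)
    where
    i+j≡n : i + length σ ≡ n
    i+j≡n = ℕ.suc-injective (begin
      suc (i + length σ)                ≡⟨ cong suc (ℕ.+-comm i (length σ)) ⟩
      suc (length σ + i)                ≡⟨ ℕ.+-suc (length σ) i ⟨
      length σ + suc i                  ≡⟨ cong (_+ suc i) (length-map (i +_) σ) ⟨
      length (map (i +_) σ) + suc i     ≡⟨ length-++ (map (i +_) σ) ⟨
      length (map (i +_) σ ++ n ∷ τ)    ≡⟨ len ⟩
      suc n                             ∎)
    σ<j : ∀ {x} → x ∈ σ → x < length σ
    σ<j {x} x∈σ = ℕ.+-cancelˡ-< i x (length σ) (ℕ.<-≤-trans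
      (ℕ.≤∧≢⇒< (ℕ.≤-pred (All.lookup (All.map⁻ ys<1+n) x∈σ))
               (λ x≡n → All.lookup (All.lookup (All.map⁻ ys≢) x∈σ) (here refl) x≡n))
      (ℕ.≤-reflexive (sym i+j≡n)))

-- From words over `Fin m` to lists of natural numbers

letters : ∀ {m k} → Word m k → List ℕ
letters []      = []
letters (x ∷ u) = toℕ x ∷ letters u

length-letters : ∀ {m k} (u : Word m k) → length (letters u) ≡ k
length-letters []      = refl
length-letters (x ∷ u) = cong suc (length-letters u)

letters-injective : ∀ {m k} {u w : Word m k} → letters u ≡ letters w → u ≡ w
letters-injective {u = []}    {[]}    _  = refl
letters-injective {u = x ∷ u} {y ∷ w} eq =
  let x≡y , u≡w = ∷-injective eq in cong₂ _∷_ (Fin.toℕ-injective x≡y) (letters-injective u≡w)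

letters-surjective : ∀ {m k xs} → length xs ≡ k → All (_< m) xs → ∃ λ (u : Word m k) → letters u ≡ xs
letters-surjective refl []           = [] , refl
letters-surjective refl (x<m ∷ xs<m) =
  let u , eq = letters-surjective refl xs<m in fromℕ< x<m ∷ u , cong₂ _∷_ (Fin.toℕ-fromℕ< x<m) eq

All-letters⁺ : ∀ {P : ℕ → Set} {m k} (u : Word m k) → (∀ i → P (toℕ (lookup u i))) → All P (letters u)
All-letters⁺ []      p = []
All-letters⁺ (x ∷ u) p = p zero ∷ All-letters⁺ u (p ∘ suc)

All-letters⁻ : ∀ {P : ℕ → Set} {m k} (u : Word m k) → All P (letters u) → ∀ i → P (toℕ (lookup u i))
All-letters⁻ (x ∷ u) (p ∷ ps) zero    = p
All-letters⁻ (x ∷ u) (p ∷ ps) (suc i) = All-letters⁻ u ps i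

AllPairs-letters⁺ : ∀ {R : ℕ → ℕ → Set} {m k} (u : Word m k) →
  (∀ i j → i Fin.< j → R (toℕ (lookup u i)) (toℕ (lookup u j))) → AllPairs R (letters u)
AllPairs-letters⁺ []      r = []
AllPairs-letters⁺ (x ∷ u) r =
  All-letters⁺ u (λ j → r zero (suc j) (s≤s z≤n)) ∷
  AllPairs-letters⁺ u (λ i j i<j → r (suc i) (suc j) (s≤s i<j))

AllPairs-letters⁻ : ∀ {R : ℕ → ℕ → Set} {m k} (u : Word m k) → AllPairs R (letters u) →
  ∀ i j → i Fin.< j → R (toℕ (lookup u i)) (toℕ (lookup u j))
AllPairs-letters⁻ (x ∷ u) (r ∷ rs) zero    (suc j) _         = All-letters⁻ u r j
AllPairs-letters⁻ (x ∷ u) (r ∷ rs) (suc i) (suc j) (s≤s i<j) = AllPairs-letters⁻ u rs i j i<j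

No132 : ∀ {m k} → Word m k → Set
No132 {k = k} u = ∀ (i j l : Fin k) → i Fin.< j → j Fin.< l →
  ¬ (lookup u i Fin.< lookup u l × lookup u l Fin.< lookup u j)

No132⇒Avoids132 : ∀ {m k} (u : Word m k) → No132 u → Avoids132 (letters u)
No132⇒Avoids132 []      _    = []
No132⇒Avoids132 (x ∷ u) free =
  AllPairs-letters⁺ u (λ j l j<l → free zero (suc j) (suc l) (s≤s z≤n) (s≤s j<l)) ∷
  No132⇒Avoids132 u (λ i j l i<j j<l → free (suc i) (suc j) (suc l) (s≤s i<j) (s≤s j<l))

Avoids132⇒No132 : ∀ {m k} (u : Word m k) → Avoids132 (letters u) → No132 u
Avoids132⇒No132 (x ∷ u) (p ∷ ps) zero    (suc j) (suc l) _         (s≤s j<l) = AllPairs-letters⁻ u p j l j<l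
Avoids132⇒No132 (x ∷ u) (p ∷ ps) (suc i) (suc j) (suc l) (s≤s i<j) (s≤s j<l) = Avoids132⇒No132 u ps i j l i<j j<l

Avoids⇒No132 : ∀ {n} (π : Word n n) → Avoids p132 π → No132 π
Avoids⇒No132 {n} π avoids i j l i<j j<l (πi<πl , πl<πj) = avoids (w , increasing , isomorphic)
  where
  w : Word n 3
  w = i ∷ j ∷ l ∷ []

  increasing : ∀ (a b : Fin 3) → a Fin.< b → lookup w a Fin.< lookup w b
  increasing zero             (suc zero)       _ = i<j
  increasing zero             (suc (suc zero)) _ = ℕ.<-trans i<j j<l
  increasing (suc zero)       (suc (suc zero)) _ = j<l
  increasing (suc zero)       (suc zero)       (s≤s ())
  increasing (suc (suc zero)) (suc zero)       (s≤s ())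
  increasing (suc (suc zero)) (suc (suc zero)) (s≤s (s≤s ()))

  both : ∀ {A B : Set} → A → B → A ⇔ B
  both a b = mk⇔ (λ _ → b) (λ _ → a)

  neither : ∀ {A B : Set} → ¬ A → ¬ B → A ⇔ B
  neither ¬a ¬b = mk⇔ (λ a → contradiction a ¬a) (λ b → contradiction b ¬b)

  isomorphic : ∀ (a b : Fin 3) →
    (lookup p132 a Fin.< lookup p132 b) ⇔ (lookup π (lookup w a) Fin.< lookup π (lookup w b))
  isomorphic zero             zero             = neither (ℕ.<-irrefl refl) (ℕ.<-irrefl refl)
  isomorphic zero             (suc zero)       = both (s≤s z≤n) (ℕ.<-trans πi<πl πl<πj)
  isomorphic zero             (suc (suc zero)) = both (s≤s z≤n) πi<πl
  isomorphic (suc zero)       zero             = neither (λ ()) (ℕ.<-asym (ℕ.<-trans πi<πl πl<πj))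
  isomorphic (suc zero)       (suc zero)       = neither (ℕ.<-irrefl refl) (ℕ.<-irrefl refl)
  isomorphic (suc zero)       (suc (suc zero)) = neither (λ { (s≤s ()) }) (ℕ.<-asym πl<πj)
  isomorphic (suc (suc zero)) zero             = neither (λ ()) (ℕ.<-asym πi<πl)
  isomorphic (suc (suc zero)) (suc zero)       = both (s≤s (s≤s z≤n)) πl<πj
  isomorphic (suc (suc zero)) (suc (suc zero)) = neither (ℕ.<-irrefl refl) (ℕ.<-irrefl refl)

No132⇒Avoids : ∀ {n} (π : Word n n) → No132 π → Avoids p132 π
No132⇒Avoids π free (i ∷ j ∷ l ∷ [] , increasing , isomorphic) =
  free i j l (increasing zero (suc zero) (s≤s z≤n)) (increasing (suc zero) (suc (suc zero)) (s≤s (s≤s z≤n)))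
    (Equivalence.to (isomorphic zero (suc (suc zero))) (s≤s z≤n) ,
     Equivalence.to (isomorphic (suc (suc zero)) (suc zero)) (s≤s (s≤s z≤n)))

∈-letters⁻ : ∀ {m k v} (u : Word m k) → v ∈ letters u → ∃ λ i → toℕ (lookup u i) ≡ v
∈-letters⁻ (x ∷ u) (here refl) = zero , refl
∈-letters⁻ (x ∷ u) (there v∈u) = let i , eq = ∈-letters⁻ u v∈u in suc i , eq

IsPermutation⇒Unique : ∀ {n} (π : Word n n) → IsPermutation π → Unique (letters π)
IsPermutation⇒Unique π (inj , _) = AllPairs-letters⁺ π
  (λ i j i<j πi≡πj → ℕ.<⇒≢ i<j (cong toℕ (inj (Fin.toℕ-injective πi≡πj))))

Unique⇒IsPermutation : ∀ {n} (π : Word n n) → Unique (letters π) → IsPermutation π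
Unique⇒IsPermutation {n} π π! = injective , strictlySurjective⇒surjective surjective
  where
  injective : ∀ {i j} → lookup π i ≡ lookup π j → i ≡ j
  injective {i} {j} πi≡πj with ℕ.<-cmp (toℕ i) (toℕ j)
  ... | tri< i<j _ _ = contradiction (cong toℕ πi≡πj) (AllPairs-letters⁻ π π! i j i<j)
  ... | tri≈ _ i≡j _ = Fin.toℕ-injective i≡j
  ... | tri> _ _ j<i = contradiction (cong toℕ (sym πi≡πj)) (AllPairs-letters⁻ π π! j i j<i)
  surjective : ∀ y → ∃ λ i → lookup π i ≡ y
  surjective y =
    let i , eq = ∈-letters⁻ π (Unique∧bounded⇒∈ (length-letters π) π!
                   (All-letters⁺ π (λ i → Fin.toℕ<n (lookup π i))) (Fin.toℕ<n y))
    in i , Fin.toℕ-injective eq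

abstract
  -- Opaque, so that the filtered enumeration behind `𝔖` is not unfolded; the lemmas of this block
  -- are its interface.
  words132 : ℕ → List (List ℕ)
  words132 n = map letters (𝔖 n p132)

  words132-def : ∀ n → words132 n ≡ map letters (𝔖 n p132)
  words132-def n = refl

  words132-zero : words132 0 ≡ [] ∷ []
  words132-zero = refl

  words132-unique : ∀ n → Unique (words132 n)
  words132-unique n = Unique.map⁺ letters-injective (𝔖-unique n p132)

  ∈-words132⁻ : ∀ {n xs} → xs ∈ words132 n → Perm132 n xs
  ∈-words132⁻ {n} xs∈ with ∈-map⁻ letters xs∈
  ... | π , π∈ , refl =
    let perm , avoids = Equivalence.to (∈-𝔖 {n = n} {τ = p132}) π∈ in
    length-letters π , All-letters⁺ π (λ i → Fin.toℕ<n (lookup π i)) ,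
    IsPermutation⇒Unique π perm , No132⇒Avoids132 π (Avoids⇒No132 π avoids)

  ∈-words132⁺ : ∀ {n xs} → Perm132 n xs → xs ∈ words132 n
  ∈-words132⁺ {n} (len , xs<n , xs! , xs-av) with letters-surjective len xs<n
  ... | π , refl = ∈-map⁺ letters (Equivalence.from (∈-𝔖 {n = n} {τ = p132})
    (Unique⇒IsPermutation π xs! , No132⇒Avoids π (Avoids132⇒No132 π xs-av)))

-- Finite sums over lists, and cutting at the maximum as a last-return recurrence

∑ᴸ : ∀ {A : Set} → (A → ℤ) → List A → ℤ
∑ᴸ f xs = foldr _+ℤ_ 0ℤ (map f xs)

∑ᴸ-↭ : ∀ {A : Set} (f : A → ℤ) {xs ys} → xs ↭ ys → ∑ᴸ f xs ≡ ∑ᴸ f ys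
∑ᴸ-↭ f xs↭ys = ↭ₛ.foldr-commMonoid (setoid ℤ) ℤ.+-0-isCommutativeMonoid (↭⇒↭ₛ (↭.map⁺ f xs↭ys))

∑ᴸ-cong : ∀ {A : Set} {f g : A → ℤ} xs → (∀ {x} → x ∈ xs → f x ≡ g x) → ∑ᴸ f xs ≡ ∑ᴸ g xs
∑ᴸ-cong []       _   = refl
∑ᴸ-cong (x ∷ xs) f≗g = cong₂ _+ℤ_ (f≗g (here refl)) (∑ᴸ-cong xs (f≗g ∘ there))

∑ᴸ-map : ∀ {A B : Set} (f : B → ℤ) (g : A → B) xs → ∑ᴸ f (map g xs) ≡ ∑ᴸ (f ∘ g) xs
∑ᴸ-map f g xs = cong (foldr _+ℤ_ 0ℤ) (sym (map-∘ xs))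

∑ᴸ-++ : ∀ {A : Set} (f : A → ℤ) xs ys → ∑ᴸ f (xs ++ ys) ≡ ∑ᴸ f xs +ℤ ∑ᴸ f ys
∑ᴸ-++ f []       ys = sym (ℤ.+-identityˡ (∑ᴸ f ys))
∑ᴸ-++ f (x ∷ xs) ys = trans (cong (f x +ℤ_) (∑ᴸ-++ f xs ys)) (sym (ℤ.+-assoc (f x) (∑ᴸ f xs) (∑ᴸ f ys)))

∑ᴸ-*ˡ : ∀ {A : Set} c (f : A → ℤ) xs → ∑ᴸ (λ x → c * f x) xs ≡ c * ∑ᴸ f xs
∑ᴸ-*ˡ c f []       = sym (ℤ.*-zeroʳ c)
∑ᴸ-*ˡ c f (x ∷ xs) = trans (cong (c * f x +ℤ_) (∑ᴸ-*ˡ c f xs)) (sym (ℤ.*-distribˡ-+ c (f x) (∑ᴸ f xs)))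

∑ᴸ-cartesianProduct : ∀ {A B : Set} (f : A → ℤ) (g : B → ℤ) xs ys →
  ∑ᴸ (λ (x , y) → f x * g y) (cartesianProduct xs ys) ≡ ∑ᴸ f xs * ∑ᴸ g ys
∑ᴸ-cartesianProduct f g []       ys = sym (ℤ.*-zeroˡ (∑ᴸ g ys))
∑ᴸ-cartesianProduct f g (x ∷ xs) ys = begin
  ∑ᴸ h (map (x ,_) ys ++ cartesianProduct xs ys)
    ≡⟨ ∑ᴸ-++ h (map (x ,_) ys) (cartesianProduct xs ys) ⟩
  ∑ᴸ h (map (x ,_) ys) +ℤ ∑ᴸ h (cartesianProduct xs ys)
    ≡⟨ cong₂ _+ℤ_ (trans (∑ᴸ-map h (x ,_) ys) (∑ᴸ-*ˡ (f x) g ys)) (∑ᴸ-cartesianProduct f g xs ys) ⟩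
  f x * ∑ᴸ g ys +ℤ ∑ᴸ f xs * ∑ᴸ g ys
    ≡⟨ ℤ.*-distribʳ-+ (∑ᴸ g ys) (f x) (∑ᴸ f xs) ⟨
  (f x +ℤ ∑ᴸ f xs) * ∑ᴸ g ys
    ∎
  where
  h = λ (x , y) → f x * g y

⋃[i+j=_] : ∀ {A : Set} → ℕ → (ℕ → ℕ → List A) → List A
⋃[i+j= zero  ] f = f 0 0
⋃[i+j= suc k ] f = f 0 (suc k) ++ ⋃[i+j= k ] (λ i j → f (suc i) j)

∑ᴸ-⋃ : ∀ {A : Set} (g : A → ℤ) k f → ∑ᴸ g (⋃[i+j= k ] f) ≡ ∑[i+j= k ] (λ i j → ∑ᴸ g (f i j))
∑ᴸ-⋃ g zero    f = refl
∑ᴸ-⋃ g (suc k) f = trans (∑ᴸ-++ g (f 0 (suc k)) (⋃[i+j= k ] (λ i j → f (suc i) j)))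
  (cong (∑ᴸ g (f 0 (suc k)) +ℤ_) (∑ᴸ-⋃ g k (λ i j → f (suc i) j)))

∈-⋃⁺ : ∀ {A : Set} {x : A} i j f → x ∈ f i j → x ∈ ⋃[i+j= i + j ] f
∈-⋃⁺ zero    zero    f x∈ = x∈
∈-⋃⁺ zero    (suc j) f x∈ = ∈-++⁺ˡ x∈
∈-⋃⁺ (suc i) j       f x∈ = ∈-++⁺ʳ (f 0 (suc (i + j))) (∈-⋃⁺ i j (λ i j → f (suc i) j) x∈)

∈-⋃⁻ : ∀ {A : Set} {x : A} k f → x ∈ ⋃[i+j= k ] f → ∃₂ λ i j → i + j ≡ k × x ∈ f i j
∈-⋃⁻ zero    f x∈ = 0 , 0 , refl , x∈
∈-⋃⁻ (suc k) f x∈ with ∈-++⁻ (f 0 (suc k)) x∈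
... | inj₁ x∈ˡ = 0 , suc k , refl , x∈ˡ
... | inj₂ x∈ʳ = let i , j , i+j≡k , x∈′ = ∈-⋃⁻ k (λ i j → f (suc i) j) x∈ʳ in suc i , j , cong suc i+j≡k , x∈′

-- The key recovers the block index, so distinct blocks are disjoint; the offset s in `shifted`
-- absorbs the reindexing at each step of the union.
⋃-unique : ∀ {A : Set} (key : A → ℕ) k f → (∀ i j → Unique (f i j)) →
           (∀ {i j x} → x ∈ f i j → key x ≡ i) → Unique (⋃[i+j= k ] f)
⋃-unique key k f f! f-key = shifted 0 k f f! f-key
  where
  shifted : ∀ s k f → (∀ i j → Unique (f i j)) →
            (∀ {i j x} → x ∈ f i j → key x ≡ s + i) → Unique (⋃[i+j= k ] f)
  shifted s zero    f f! f-key = f! 0 0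
  shifted s (suc k) f f! f-key = Unique.++⁺ (f! 0 (suc k))
    (shifted (suc s) k (λ i j → f (suc i) j) (λ i j → f! (suc i) j) (λ {i} x∈ → trans (f-key x∈) (ℕ.+-suc s i)))
    λ (x∈ˡ , x∈ʳ) → let i , j , _ , x∈ = ∈-⋃⁻ k (λ i j → f (suc i) j) x∈ʳ in
      ℕ.0≢1+n (ℕ.+-cancelˡ-≡ s 0 (suc i) (trans (sym (f-key x∈ˡ)) (f-key x∈)))

-- Injectivity is asked only on the list: `⊘` does not have it on arbitrary words, since
-- `[] ⊘ (1 ∷ [])` and `(1 ∷ []) ⊘ []` agree.
map-unique-on : ∀ {A B : Set} (f : A → B) {xs} →
  (∀ {x y} → x ∈ xs → y ∈ xs → f x ≡ f y → x ≡ y) → Unique xs → Unique (map f xs)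
map-unique-on f inj []           = []
map-unique-on f inj (x∉xs ∷ xs!) =
  All.map⁺ (All.tabulate λ y∈xs fx≡fy → All.lookup x∉xs y∈xs (inj (here refl) (there y∈xs) fx≡fy)) ∷
  map-unique-on f (λ x∈ y∈ → inj (there x∈) (there y∈)) xs!

⊘-pairs : ℕ → List (List ℕ × List ℕ)
⊘-pairs n = ⋃[i+j= n ] (λ i j → cartesianProduct (words132 j) (words132 i))

∈-⊘-pairs⁻ : ∀ {n σ τ} → (σ , τ) ∈ ⊘-pairs n → ∃₂ λ i j → i + j ≡ n × Perm132 j σ × Perm132 i τ
∈-⊘-pairs⁻ {n} στ∈ =
  let i , j , i+j≡n , ∈ij = ∈-⋃⁻ n _ στ∈ ; σ∈ , τ∈ = ∈-cartesianProduct⁻ (words132 j) (words132 i) ∈ij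
  in i , j , i+j≡n , ∈-words132⁻ σ∈ , ∈-words132⁻ τ∈

-- Two duplicate-free lists with the same members are rearrangements of each other, so the bijection
-- given by the cut at the maximum can be used inside sums.
words132-suc : ∀ n → words132 (suc n) ↭ map (uncurry _⊘_) (⊘-pairs n)
words132-suc n = ∼bag⇒↭ (unique∧set⇒bag (words132-unique (suc n)) pairs! (mk⇔ to from))
  where
  pairs! : Unique (map (uncurry _⊘_) (⊘-pairs n))
  pairs! = map-unique-on (uncurry _⊘_)
    (λ {(σ , τ)} {(σ′ , τ′)} στ∈ στ′∈ eq →
      let _ , _ , i+j≡n   , pσ  , pτ  = ∈-⊘-pairs⁻ {n} στ∈
          _ , _ , i′+j′≡n , pσ′ , pτ′ = ∈-⊘-pairs⁻ {n} στ′∈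
      in uncurry (cong₂ _,_) (⊘-injective (trans i+j≡n (sym i′+j′≡n)) pσ pτ pσ′ pτ′ eq))
    (⋃-unique (length ∘ proj₂) n _
      (λ i j → Unique.cartesianProduct⁺ (words132-unique j) (words132-unique i))
      (λ {i} {j} στ∈ → proj₁ (∈-words132⁻ (proj₂ (∈-cartesianProduct⁻ (words132 j) (words132 i) στ∈)))))

  to : ∀ {xs} → xs ∈ words132 (suc n) → xs ∈ map (uncurry _⊘_) (⊘-pairs n)
  to xs∈ with i , j , refl , σ , τ , pσ , pτ , refl ← ⊘-surjective (∈-words132⁻ xs∈) =
    ∈-map⁺ (uncurry _⊘_) (∈-⋃⁺ i j _ (∈-cartesianProduct⁺ (∈-words132⁺ pσ) (∈-words132⁺ pτ)))

  from : ∀ {xs} → xs ∈ map (uncurry _⊘_) (⊘-pairs n) → xs ∈ words132 (suc n)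
  from xs∈ with (σ , τ) , στ∈ , refl ← ∈-map⁻ (uncurry _⊘_) xs∈
           with i , j , refl , pσ , pτ ← ∈-⊘-pairs⁻ {n} στ∈ = ∈-words132⁺ (⊘-Perm132 pσ pτ)

module Weighted (v : ℕ → ℤ) where
  -- An entry x followed by l further letters corresponds to a tunnel with
  -- midpoint x + l + 1, which is n + (x - i) for the i-th of n letters (i from 0).
  weight : ℕ → List ℕ → ℤ
  weight e []       = 1ℤ
  weight e (x ∷ xs) = v (e + x + suc (length xs)) * weight e xs

  Q : ℕ → ℕ → ℤ
  Q n e = ∑ᴸ (weight e) (words132 n)

  Q-zero : ∀ e → Q 0 e ≡ 1ℤ
  Q-zero e = cong (∑ᴸ (weight e)) words132-zero

  -- Relative to e, the midpoint of an entry is its value plus the number of letters from it on;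
  -- raising the values by i and appending ys therefore only moves the starting abscissa.
  weight-map-++ : ∀ e i xs ys →
    weight e (map (i +_) xs ++ ys) ≡ weight (e + (i + length ys)) xs * weight e ys
  weight-map-++ e i []       ys = sym (ℤ.*-identityˡ (weight e ys))
  weight-map-++ e i (x ∷ xs) ys = trans
    (cong₂ _*_
      (cong v (trans (cong (λ l → e + (i + x) + suc l) (trans (length-++ (map (i +_) xs)) (cong (_+ length ys) (length-map (i +_) xs))))
                     (mid e i x (length xs) (length ys))))
      (weight-map-++ e i xs ys))
    (sym (ℤ.*-assoc (v (e + (i + length ys) + x + suc (length xs))) (weight (e + (i + length ys)) xs) (weight e ys)))
    where
    mid : ∀ e i x l m → e + (i + x) + suc (l + m) ≡ e + (i + m) + x + suc l
    mid = ℕ-Ring.solve-∀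

  -- As a path, τ comes first although it is written last: it keeps the abscissa e, the maximum is
  -- the arch after it, and σ, raised by i and followed by i + 1 letters, starts at e + 2i + 1, just
  -- inside that arch.
  weight-⊘ : ∀ e {i j} σ τ → length σ ≡ j → length τ ≡ i →
    weight e (σ ⊘ τ) ≡ v (e + suc (i + j) + i) * (weight (e + (i + suc i)) σ * weight e τ)
  weight-⊘ e σ τ refl refl = begin
    weight e (σ ⊘ τ)
      ≡⟨ weight-map-++ e (length τ) σ _ ⟩
    x * (v (e + (length τ + length σ) + suc (length τ)) * y)
      ≡⟨ cong (λ m → x * (v m * y)) (mid e (length τ) (length σ)) ⟩
    x * (v (e + suc (length τ + length σ) + length τ) * y)
      ≡⟨ rotate x (v (e + suc (length τ + length σ) + length τ)) y ⟩
    v (e + suc (length τ + length σ) + length τ) * (x * y)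
      ∎
    where
    x = weight (e + (length τ + suc (length τ))) σ
    y = weight e τ
    mid : ∀ e i j → e + (i + j) + suc i ≡ e + suc (i + j) + i
    mid = ℕ-Ring.solve-∀
    rotate : ∀ x z y → x * (z * y) ≡ z * (x * y)
    rotate = ℤ-Ring.solve-∀

  last-return : ∀ n e → Q (suc n) e ≡
    ∑[i+j= n ] (λ i j → v (e + suc n + i) * Q i e * Q j (e + (i + suc i)))
  last-return n e = begin
    Q (suc n) e
      ≡⟨ ∑ᴸ-↭ (weight e) (words132-suc n) ⟩
    ∑ᴸ (weight e) (map (uncurry _⊘_) (⊘-pairs n))
      ≡⟨ ∑ᴸ-map (weight e) (uncurry _⊘_) (⊘-pairs n) ⟩
    ∑ᴸ (weight e ∘ uncurry _⊘_) (⊘-pairs n)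
      ≡⟨ ∑ᴸ-⋃ (weight e ∘ uncurry _⊘_) n _ ⟩
    ∑[i+j= n ] (λ i j → ∑ᴸ (weight e ∘ uncurry _⊘_) (cartesianProduct (words132 j) (words132 i)))
      ≡⟨ ∑-cong n (λ { i j refl → block i j }) ⟩
    ∑[i+j= n ] (λ i j → v (e + suc n + i) * Q i e * Q j (e + (i + suc i)))
      ∎
    where
    regroup : ∀ x y z → x * (y * z) ≡ x * z * y
    regroup = ℤ-Ring.solve-∀

    block : ∀ i j → ∑ᴸ (weight e ∘ uncurry _⊘_) (cartesianProduct (words132 j) (words132 i)) ≡
                    v (e + suc (i + j) + i) * Q i e * Q j (e + (i + suc i))
    block i j = begin
      ∑ᴸ (weight e ∘ uncurry _⊘_) pairs
        ≡⟨ ∑ᴸ-cong pairs (λ {(σ , τ)} στ∈ → let σ∈ , τ∈ = ∈-cartesianProduct⁻ (words132 j) (words132 i) στ∈ in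
             weight-⊘ e σ τ (proj₁ (∈-words132⁻ σ∈)) (proj₁ (∈-words132⁻ τ∈))) ⟩
      ∑ᴸ (λ (σ , τ) → c * (weight (e + (i + suc i)) σ * weight e τ)) pairs
        ≡⟨ ∑ᴸ-*ˡ c _ pairs ⟩
      c * ∑ᴸ (λ (σ , τ) → weight (e + (i + suc i)) σ * weight e τ) pairs
        ≡⟨ cong (c *_) (∑ᴸ-cartesianProduct (weight (e + (i + suc i))) (weight e) (words132 j) (words132 i)) ⟩
      c * (Q j (e + (i + suc i)) * Q i e)
        ≡⟨ regroup c (Q j (e + (i + suc i))) (Q i e) ⟩
      c * Q i e * Q j (e + (i + suc i))
        ∎
      where
      c = v (e + suc (i + j) + i)
      pairs = cartesianProduct (words132 j) (words132 i)

  tunnelSums : TunnelSums v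
  tunnelSums = record { Q = Q ; Q-zero = Q-zero ; last-return = last-return }

-- Excedances, and the reverse-complement from 213 to 132

∏ᶠ : ∀ k → (Fin k → ℤ) → ℤ
∏ᶠ zero    f = 1ℤ
∏ᶠ (suc k) f = f zero * ∏ᶠ k (f ∘ suc)

∏ᶠ-cong : ∀ k {f g : Fin k → ℤ} → (∀ i → f i ≡ g i) → ∏ᶠ k f ≡ ∏ᶠ k g
∏ᶠ-cong zero    f≗g = refl
∏ᶠ-cong (suc k) f≗g = cong₂ _*_ (f≗g zero) (∏ᶠ-cong k (f≗g ∘ suc))

∏ᶠ-zero : ∀ k {f : Fin k → ℤ} i → f i ≡ 0ℤ → ∏ᶠ k f ≡ 0ℤ
∏ᶠ-zero (suc k) {f} zero    f0≡0 = trans (cong (_* ∏ᶠ k (f ∘ suc)) f0≡0) (ℤ.*-zeroˡ (∏ᶠ k (f ∘ suc)))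
∏ᶠ-zero (suc k) {f} (suc i) fi≡0 = trans (cong (f zero *_) (∏ᶠ-zero k i fi≡0)) (ℤ.*-zeroʳ (f zero))

∏ᶠ-last : ∀ k (f : Fin (suc k) → ℤ) → ∏ᶠ (suc k) f ≡ f (fromℕ k) * ∏ᶠ k (f ∘ inject₁)
∏ᶠ-last zero    f = refl
∏ᶠ-last (suc k) f = trans (cong (f zero *_) (∏ᶠ-last k (f ∘ suc)))
  (swap (f zero) (f (fromℕ (suc k))) (∏ᶠ k (f ∘ suc ∘ inject₁)))
  where
  swap : ∀ x y z → x * (y * z) ≡ y * (x * z)
  swap = ℤ-Ring.solve-∀

∏ᶠ-opposite : ∀ k (f : Fin k → ℤ) → ∏ᶠ k f ≡ ∏ᶠ k (f ∘ opposite)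
∏ᶠ-opposite zero    f = refl
∏ᶠ-opposite (suc k) f = trans (∏ᶠ-last k f) (cong (f (fromℕ k) *_) (∏ᶠ-opposite k (f ∘ inject₁)))

module _ (p x q : ℤ) where
  -- Read at a position and its entry, p, x and q weigh deficiencies, fixed points and excedances;
  -- read at the middle abscissa and a midpoint, they weigh left, centred and right tunnels.
  byOrder : ℕ → ℕ → ℤ
  byOrder a b with ℕ.<-cmp b a
  ... | tri< _ _ _ = p
  ... | tri≈ _ _ _ = x
  ... | tri> _ _ _ = q

  byOrder-< : ∀ {a b} → b < a → byOrder a b ≡ p
  byOrder-< {a} {b} b<a with ℕ.<-cmp b a
  ... | tri< _ _ _   = refl
  ... | tri≈ b≮a _ _ = contradiction b<a b≮a
  ... | tri> b≮a _ _ = contradiction b<a b≮a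

  byOrder-≡ : ∀ {a b} → b ≡ a → byOrder a b ≡ x
  byOrder-≡ {a} {b} b≡a with ℕ.<-cmp b a
  ... | tri< _ b≢a _ = contradiction b≡a b≢a
  ... | tri≈ _ _ _   = refl
  ... | tri> _ b≢a _ = contradiction b≡a b≢a

  byOrder-> : ∀ {a b} → a < b → byOrder a b ≡ q
  byOrder-> {a} {b} a<b with ℕ.<-cmp b a
  ... | tri< _ _ a≮b = contradiction a<b a≮b
  ... | tri≈ _ _ a≮b = contradiction a<b a≮b
  ... | tri> _ _ _   = refl

  -- An entry y at position i of a word of length n has n - i letters from it on, so its tunnel has
  -- midpoint y + (n - i), which compares with n as y does with i.
  byOrder-shift : ∀ {i n} y → i ≤ n → byOrder n (y + (n ∸ i)) ≡ byOrder i y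
  byOrder-shift {i} {n} y i≤n = trans (cong (λ m → byOrder m (y + d)) (sym (ℕ.m+[n∸m]≡n i≤n))) shift
    where
    d = n ∸ i
    shift : byOrder (i + d) (y + d) ≡ byOrder i y
    shift with ℕ.<-cmp y i
    ... | tri< y<i _ _ = byOrder-< (ℕ.+-monoˡ-< d y<i)
    ... | tri≈ _ y≡i _ = byOrder-≡ (cong (_+ d) y≡i)
    ... | tri> _ _ i<y = byOrder-> (ℕ.+-monoˡ-< d i<y)

  signed : ∀ {n} → Word n n → ℤ
  signed {n} π = ∏ᶠ n (λ i → byOrder (toℕ i) (toℕ (lookup π i)))

byOrder-reflect : ∀ p x q {n m m′} → m + m′ ≡ n + n → byOrder p x q n m ≡ byOrder q x p n m′
byOrder-reflect p x q {n} {m} {m′} m+m′≡2n with ℕ.<-cmp m n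
... | tri< m<n _ _ = sym (byOrder-> q x p (ℕ.≰⇒> λ m′≤n → ℕ.<⇒≢ (ℕ.+-mono-<-≤ m<n m′≤n) m+m′≡2n))
... | tri≈ _ refl _ = sym (byOrder-≡ q x p (ℕ.+-cancelˡ-≡ m m′ m m+m′≡2n))
... | tri> _ _ n<m = sym (byOrder-< q x p (ℕ.≰⇒> λ n≤m′ → ℕ.<⇒≢ (ℕ.+-mono-<-≤ n<m n≤m′) (sym m+m′≡2n)))

opposite-< : ∀ {n} {i j : Fin n} → i Fin.< j → opposite j Fin.< opposite i
opposite-< {n} {i} {j} i<j rewrite Fin.opposite-prop i | Fin.opposite-prop j =
  ℕ.∸-monoʳ-< (s≤s i<j) (Fin.toℕ<n j)

byOrder-opposite : ∀ p x q {n} (i y : Fin n) →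
  byOrder p x q (toℕ (opposite i)) (toℕ (opposite y)) ≡ byOrder q x p (toℕ i) (toℕ y)
byOrder-opposite p x q i y with ℕ.<-cmp (toℕ y) (toℕ i)
... | tri< y<i _ _ = byOrder-> p x q (opposite-< y<i)
... | tri≈ _ y≡i _ = byOrder-≡ p x q (cong (toℕ ∘ opposite) (Fin.toℕ-injective y≡i))
... | tri> _ _ i<y = byOrder-< p x q (opposite-< i<y)

-- Lets a vanishing weight do the filtering: at x = 0 the permutations with a fixed point contribute
-- nothing.
∑ᴸ-filter : ∀ {A : Set} {P : A → Set} (P? : Decidable P) {f g : A → ℤ} →
  (∀ x → P x → f x ≡ g x) → (∀ x → ¬ P x → g x ≡ 0ℤ) → ∀ xs → ∑ᴸ f (filter P? xs) ≡ ∑ᴸ g xs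
∑ᴸ-filter P? f≗g g≡0 []       = refl
∑ᴸ-filter P? {f} {g} f≗g g≡0 (x ∷ xs) with P? x
... | yes px = cong₂ _+ℤ_ (f≗g x px) (∑ᴸ-filter P? f≗g g≡0 xs)
... | no ¬px = trans (∑ᴸ-filter P? f≗g g≡0 xs)
  (sym (trans (cong (_+ℤ ∑ᴸ g xs) (g≡0 x ¬px)) (ℤ.+-identityˡ (∑ᴸ g xs))))

-1^length-filter : ∀ {A : Set} {P : A → Set} (P? : Decidable P) k (g : Fin k → A) →
  -1ℤ ^ length (filter P? (tabulate g)) ≡ ∏ᶠ k (λ i → if does (P? (g i)) then -1ℤ else 1ℤ)
-1^length-filter P? zero    g = refl
-1^length-filter P? (suc k) g with does (P? (g zero))
... | true  = cong (-1ℤ *_) (-1^length-filter P? k (g ∘ suc))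
... | false = trans (-1^length-filter P? k (g ∘ suc)) (sym (ℤ.*-identityˡ _))

-1^exc≡signed : ∀ {n} (π : Word n n) → -1ℤ ^ exc π ≡ signed 1ℤ 1ℤ -1ℤ π
-1^exc≡signed {n} π = trans (-1^length-filter (λ i → i Fin.<? lookup π i) n id) (∏ᶠ-cong n factor)
  where
  factor : ∀ i → (if does (i Fin.<? lookup π i) then -1ℤ else 1ℤ) ≡ byOrder 1ℤ 1ℤ -1ℤ (toℕ i) (toℕ (lookup π i))
  factor i with ℕ.<-cmp (toℕ (lookup π i)) (toℕ i)
  ... | tri< _ _ i≮πi = cong (if_then -1ℤ else 1ℤ) (dec-false (i Fin.<? lookup π i) i≮πi)
  ... | tri≈ _ _ i≮πi = cong (if_then -1ℤ else 1ℤ) (dec-false (i Fin.<? lookup π i) i≮πi)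
  ... | tri> _ _ i<πi = cong (if_then -1ℤ else 1ℤ) (dec-true (i Fin.<? lookup π i) i<πi)

∑[-1]^exc≡∑signed : ∀ {n} (πs : List (Word n n)) → ∑[-1]^exc πs ≡ ∑ᴸ (signed 1ℤ 1ℤ -1ℤ) πs
∑[-1]^exc≡∑signed πs = ∑ᴸ-cong πs (λ {π} _ → -1^exc≡signed π)

NoFixedPoint⇒signed : ∀ {n} (π : Word n n) → NoFixedPoint π → signed 1ℤ 1ℤ -1ℤ π ≡ signed 1ℤ 0ℤ -1ℤ π
NoFixedPoint⇒signed {n} π nofix = ∏ᶠ-cong n factor
  where
  factor : ∀ i → byOrder 1ℤ 1ℤ -1ℤ (toℕ i) (toℕ (lookup π i)) ≡ byOrder 1ℤ 0ℤ -1ℤ (toℕ i) (toℕ (lookup π i))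
  factor i with ℕ.<-cmp (toℕ (lookup π i)) (toℕ i)
  ... | tri< _ _ _    = refl
  ... | tri≈ _ πi≡i _ = contradiction (Fin.toℕ-injective πi≡i) (nofix i)
  ... | tri> _ _ _    = refl

fixedPoint⇒signed≡0 : ∀ p q {n} (π : Word n n) → ¬ NoFixedPoint π → signed p 0ℤ q π ≡ 0ℤ
fixedPoint⇒signed≡0 p q {n} π fix =
  let i , ¬πi≢i = Fin.¬∀⟶∃¬ n (λ i → lookup π i ≢ i) (λ i → ¬? (lookup π i Fin.≟ i)) fix
  in ∏ᶠ-zero n i (byOrder-≡ p 0ℤ q (cong toℕ (decidable-stable (lookup π i Fin.≟ i) ¬πi≢i)))

∑[-1]^exc-derangements : ∀ {n} (πs : List (Word n n)) →
  ∑[-1]^exc (filter noFixedPoint? πs) ≡ ∑ᴸ (signed 1ℤ 0ℤ -1ℤ) πs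
∑[-1]^exc-derangements = ∑ᴸ-filter noFixedPoint?
  (λ π nofix → trans (-1^exc≡signed π) (NoFixedPoint⇒signed π nofix))
  (fixedPoint⇒signed≡0 1ℤ -1ℤ)

rc : ∀ {m k} → Word m k → Word m k
rc u = Vec.tabulate (λ i → opposite (lookup u (opposite i)))

lookup-rc : ∀ {m k} (u : Word m k) i → lookup (rc u) i ≡ opposite (lookup u (opposite i))
lookup-rc u = lookup∘tabulate (λ i → opposite (lookup u (opposite i)))

rc-involutive : ∀ {m k} (u : Word m k) → rc (rc u) ≡ u
rc-involutive u = trans (tabulate-cong λ i → begin
  opposite (lookup (rc u) (opposite i))                 ≡⟨ cong opposite (lookup-rc u (opposite i)) ⟩
  opposite (opposite (lookup u (opposite (opposite i)))) ≡⟨ Fin.opposite-involutive _ ⟩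
  lookup u (opposite (opposite i))                      ≡⟨ cong (lookup u) (Fin.opposite-involutive i) ⟩
  lookup u i                                            ∎)
  (tabulate∘lookup u)

opposite-<⇔ : ∀ {n} {i j : Fin n} → (i Fin.< j) ⇔ (opposite j Fin.< opposite i)
opposite-<⇔ {i = i} {j} = mk⇔ opposite-<
  (λ oj<oi → subst₂ Fin._<_ (Fin.opposite-involutive i) (Fin.opposite-involutive j) (opposite-< oj<oi))

-- The positions of an occurrence transform like the words themselves: `rc w` lists the opposite
-- positions from the other end, and `opposite` reverses the order of positions and of values alike.
rc-Contains : ∀ {k n} (τ : Word k k) (π : Word n n) → Contains τ π → Contains (rc τ) (rc π)
rc-Contains τ π (w , increasing , isomorphic) = rc w , rc-increasing , rc-isomorphic
  where
  rc-increasing : ∀ a b → a Fin.< b → lookup (rc w) a Fin.< lookup (rc w) b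
  rc-increasing a b a<b = subst₂ Fin._<_ (sym (lookup-rc w a)) (sym (lookup-rc w b))
    (opposite-< (increasing (opposite b) (opposite a) (opposite-< a<b)))

  entry : ∀ a → lookup (rc π) (lookup (rc w) a) ≡ opposite (lookup π (lookup w (opposite a)))
  entry a = begin
    lookup (rc π) (lookup (rc w) a)                        ≡⟨ cong (lookup (rc π)) (lookup-rc w a) ⟩
    lookup (rc π) (opposite (lookup w (opposite a)))       ≡⟨ lookup-rc π _ ⟩
    opposite (lookup π (opposite (opposite (lookup w (opposite a)))))
      ≡⟨ cong (opposite ∘ lookup π) (Fin.opposite-involutive _) ⟩
    opposite (lookup π (lookup w (opposite a)))            ∎

  rc-isomorphic : ∀ a b → (lookup (rc τ) a Fin.< lookup (rc τ) b) ⇔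
                          (lookup (rc π) (lookup (rc w) a) Fin.< lookup (rc π) (lookup (rc w) b))
  rc-isomorphic a b rewrite lookup-rc τ a | lookup-rc τ b | entry a | entry b =
    ⇔-trans (⇔-sym opposite-<⇔) (⇔-trans (isomorphic (opposite b) (opposite a)) opposite-<⇔)

rc-IsPermutation : ∀ {n} (π : Word n n) → IsPermutation π → IsPermutation (rc π)
rc-IsPermutation π (inj , surj) = injective , strictlySurjective⇒surjective surjective
  where
  opposite-injective : ∀ {n} {i j : Fin n} → opposite i ≡ opposite j → i ≡ j
  opposite-injective {i = i} {j} eq =
    trans (sym (Fin.opposite-involutive i)) (trans (cong opposite eq) (Fin.opposite-involutive j))
  injective : ∀ {i j} → lookup (rc π) i ≡ lookup (rc π) j → i ≡ j
  injective {i} {j} eq = opposite-injective (inj (opposite-injective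
    (trans (sym (lookup-rc π i)) (trans eq (lookup-rc π j)))))
  surjective : ∀ y → ∃ λ i → lookup (rc π) i ≡ y
  surjective y = let i , πi≡oy = surjective⇒strictlySurjective surj (opposite y) in opposite i , (begin
    lookup (rc π) (opposite i)                    ≡⟨ lookup-rc π (opposite i) ⟩
    opposite (lookup π (opposite (opposite i)))   ≡⟨ cong (opposite ∘ lookup π) (Fin.opposite-involutive i) ⟩
    opposite (lookup π i)                         ≡⟨ cong opposite πi≡oy ⟩
    opposite (opposite y)                         ≡⟨ Fin.opposite-involutive y ⟩
    y                                             ∎)

rc-𝔖 : ∀ {k n} (τ : Word k k) {π : Word n n} → π ∈ 𝔖 n (rc τ) → rc π ∈ 𝔖 n τ
rc-𝔖 {n = n} τ {π} π∈ =
  let perm , avoids = Equivalence.to (∈-𝔖 {n = n} {τ = rc τ}) π∈ in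
  Equivalence.from (∈-𝔖 {n = n} {τ = τ})
    (rc-IsPermutation π perm , λ c → avoids (subst (Contains (rc τ)) (rc-involutive π) (rc-Contains τ (rc π) c)))

𝔖-213↭rc-132 : ∀ n → 𝔖 n p213 ↭ map rc (𝔖 n p132)
𝔖-213↭rc-132 n = ∼bag⇒↭ (unique∧set⇒bag (𝔖-unique n p213)
  (Unique.map⁺ (λ {u} {w} eq → trans (sym (rc-involutive u)) (trans (cong rc eq) (rc-involutive w))) (𝔖-unique n p132))
  (mk⇔ to from))
  where
  to : ∀ {π} → π ∈ 𝔖 n p213 → π ∈ map rc (𝔖 n p132)
  -- `rc p132` and `p213` compute to the same word, as do `rc p213` and `p132`.
  to {π} π∈ = subst (_∈ map rc (𝔖 n p132)) (rc-involutive π) (∈-map⁺ rc (rc-𝔖 p132 π∈))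
  from : ∀ {π} → π ∈ map rc (𝔖 n p132) → π ∈ 𝔖 n p213
  from π∈ with _ , σ∈ , refl ← ∈-map⁻ rc π∈ = rc-𝔖 p213 σ∈

signed-rc : ∀ p x q {n} (π : Word n n) → signed p x q (rc π) ≡ signed q x p π
signed-rc p x q {n} π = begin
  ∏ᶠ n (λ i → byOrder p x q (toℕ i) (toℕ (lookup (rc π) i)))
    ≡⟨ ∏ᶠ-opposite n _ ⟩
  ∏ᶠ n (λ i → byOrder p x q (toℕ (opposite i)) (toℕ (lookup (rc π) (opposite i))))
    ≡⟨ ∏ᶠ-cong n (λ i → trans
         (cong (λ y → byOrder p x q (toℕ (opposite i)) (toℕ y))
           (trans (lookup-rc π (opposite i)) (cong (opposite ∘ lookup π) (Fin.opposite-involutive i))))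
         (byOrder-opposite p x q i (lookup π i))) ⟩
  ∏ᶠ n (λ i → byOrder q x p (toℕ i) (toℕ (lookup π i)))
    ∎

weight-letters : ∀ v e {m k} (u : Word m k) →
  Weighted.weight v e (letters u) ≡ ∏ᶠ k (λ i → v (e + toℕ (lookup u i) + (k ∸ toℕ i)))
weight-letters v e []      = refl
weight-letters v e (x ∷ u) =
  cong₂ _*_ (cong (λ l → v (e + toℕ x + suc l)) (length-letters u)) (weight-letters v e u)

∑signed-132 : ∀ p x q n → ∑ᴸ (signed p x q) (𝔖 n p132) ≡ Weighted.Q (byOrder p x q n) n 0
∑signed-132 p x q n = begin
  ∑ᴸ (signed p x q) (𝔖 n p132)
    ≡⟨ ∑ᴸ-cong (𝔖 n p132) (λ {π} _ → sym (trans (weight-letters v 0 π)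
         (∏ᶠ-cong n λ i → byOrder-shift p x q (toℕ (lookup π i)) (ℕ.<⇒≤ (Fin.toℕ<n i))))) ⟩
  ∑ᴸ (weight 0 ∘ letters) (𝔖 n p132)
    ≡⟨ ∑ᴸ-map (weight 0) letters (𝔖 n p132) ⟨
  ∑ᴸ (weight 0) (map letters (𝔖 n p132))
    ≡⟨ cong (∑ᴸ (weight 0)) (words132-def n) ⟨
  Q n 0
    ∎
  where
  v = byOrder p x q n
  open Weighted v

∑signed-213 : ∀ p x q n → ∑ᴸ (signed p x q) (𝔖 n p213) ≡ Weighted.Q (byOrder p x q n) n 0
∑signed-213 p x q n = begin
  ∑ᴸ (signed p x q) (𝔖 n p213)
    ≡⟨ ∑ᴸ-↭ (signed p x q) (𝔖-213↭rc-132 n) ⟩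
  ∑ᴸ (signed p x q) (map rc (𝔖 n p132))
    ≡⟨ ∑ᴸ-map (signed p x q) rc (𝔖 n p132) ⟩
  ∑ᴸ (signed p x q ∘ rc) (𝔖 n p132)
    ≡⟨ ∑ᴸ-cong (𝔖 n p132) (λ {π} _ → signed-rc p x q π) ⟩
  ∑ᴸ (signed q x p) (𝔖 n p132)
    ≡⟨ ∑signed-132 q x p n ⟩
  Weighted.Q (byOrder q x p n) n 0
    ≡⟨ Q-reverse (Weighted.tunnelSums (byOrder q x p n)) (Weighted.tunnelSums (byOrder p x q n))
         (n + n) (λ m m′ → byOrder-reflect q x p) n 0 0 refl ⟩
  Weighted.Q (byOrder p x q n) n 0
    ∎

Q≡α : ∀ x n → Weighted.Q (byOrder 1ℤ x -1ℤ n) n 0 ≡ α x 0 n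
Q≡α x n = trans
  (Centred.Q-centred (Weighted.tunnelSums (byOrder 1ℤ x -1ℤ n)) n
    (λ m → byOrder-< 1ℤ x -1ℤ) (λ m → byOrder-> 1ℤ x -1ℤ))
  (cong (λ y → α y 0 n) (byOrder-≡ 1ℤ x -1ℤ refl))

-- Parity and the closed forms

even⊎odd : ∀ n → (∃ λ j → n ≡ j ℕ.* 2) ⊎ (∃ λ j → n ≡ suc (j ℕ.* 2))
even⊎odd zero    = inj₁ (0 , refl)
even⊎odd (suc n) with even⊎odd n
... | inj₁ (j , refl) = inj₂ (j , refl)
... | inj₂ (j , refl) = inj₁ (suc j , refl)

2∤1+2j : ∀ j → ¬ 2 ∣ suc (j ℕ.* 2)
2∤1+2j j 2∣1+2j = contradiction (∣1⇒≡1 (∣m+n∣m⇒∣n (subst (2 ∣_) (ℕ.+-comm 1 (j ℕ.* 2)) 2∣1+2j) (divides j refl))) λ ()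

α₁-value : ∀ n → n ≥ 1 → α 1ℤ 0 n ≡
  (if ⌊ 2 ∣? n ⌋ then 0ℤ else (-1ℤ ^ ((n ∸ 1) / 2)) * pos (catalan ((n ∸ 1) / 2)))
α₁-value n n≥1 with even⊎odd n | 2 ∣? n
-- Even lengths start at `suc j` because n is positive: in C(-y)^0 the coefficient of y^0 is 1 and
-- all others vanish.
... | inj₁ (suc j , refl) | yes _     = α₁-even 0 (suc j)
... | inj₁ (suc j , refl) | no  2∤n   = contradiction (divides (suc j) refl) 2∤n
... | inj₂ (j , refl)     | yes 2∣n   = contradiction 2∣n (2∤1+2j j)
... | inj₂ (j , refl)     | no  _     rewrite ℕ.m*n/n≡m j 2 ⦃ _ ⦄ = trans (α₁-odd 0 j) (κ₁≡±catalan j)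

α₀-value : ∀ n → α 0ℤ 0 n ≡
  (if ⌊ 2 ∣? n ⌋ then (-1ℤ ^ (n / 2)) * pos (catalan (n / 2)) else 0ℤ)
α₀-value n with even⊎odd n | 2 ∣? n
... | inj₁ (j , refl) | yes _     rewrite ℕ.m*n/n≡m j 2 ⦃ _ ⦄ = trans (α₀-even 0 j) (κ₁≡±catalan j)
... | inj₁ (j , refl) | no  2∤n   = contradiction (divides j refl) 2∤n
... | inj₂ (j , refl) | yes 2∣n   = contradiction 2∣n (2∤1+2j j)
... | inj₂ (j , refl) | no  _     = α₀-odd 0 j

-- Opened only here: earlier it would make sections such as (i +_) ambiguous.
open import Data.Integer using (+_)

theorem5p9 : ∀ (n : ℕ) → n ≥ 1 →
    (∑[-1]^exc (𝔖 n p213) ≡ ∑[-1]^exc (𝔖 n p132)) ×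
    (∑[-1]^exc (𝔖 n p132) ≡
    (if ⌊ 2 ∣? n ⌋ then 0ℤ else (-1ℤ ^ ((n ∸ 1) / 2)) * (+ catalan ((n ∸ 1) / 2)))) ×
    (∑[-1]^exc (𝔇 n p213) ≡ ∑[-1]^exc (𝔇 n p132)) ×
    (∑[-1]^exc (𝔇 n p132) ≡
    (if ⌊ 2 ∣? n ⌋ then (-1ℤ ^ (n / 2)) * (+ catalan (n / 2)) else 0ℤ))
theorem5p9 n n≥1 =
  trans 𝔖₂₁₃ (sym 𝔖₁₃₂) , trans 𝔖₁₃₂ (trans (Q≡α 1ℤ n) (α₁-value n n≥1)) ,
  trans 𝔇₂₁₃ (sym 𝔇₁₃₂) , trans 𝔇₁₃₂ (trans (Q≡α 0ℤ n) (α₀-value n))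
  where
  𝔖₁₃₂ : ∑[-1]^exc (𝔖 n p132) ≡ Weighted.Q (byOrder 1ℤ 1ℤ -1ℤ n) n 0
  𝔖₁₃₂ = trans (∑[-1]^exc≡∑signed (𝔖 n p132)) (∑signed-132 1ℤ 1ℤ -1ℤ n)

  𝔖₂₁₃ : ∑[-1]^exc (𝔖 n p213) ≡ Weighted.Q (byOrder 1ℤ 1ℤ -1ℤ n) n 0
  𝔖₂₁₃ = trans (∑[-1]^exc≡∑signed (𝔖 n p213)) (∑signed-213 1ℤ 1ℤ -1ℤ n)

  𝔇₁₃₂ : ∑[-1]^exc (𝔇 n p132) ≡ Weighted.Q (byOrder 1ℤ 0ℤ -1ℤ n) n 0
  𝔇₁₃₂ = trans (∑[-1]^exc-derangements (𝔖 n p132)) (∑signed-132 1ℤ 0ℤ -1ℤ n)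

  𝔇₂₁₃ : ∑[-1]^exc (𝔇 n p213) ≡ Weighted.Q (byOrder 1ℤ 0ℤ -1ℤ n) n 0
  𝔇₂₁₃ = trans (∑[-1]^exc-derangements (𝔖 n p213)) (∑signed-213 1ℤ 0ℤ -1ℤ n)
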